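{- Let $n \ge 2$ be an integer and let $G(\mathbb{Z}_n)$ be the unit graph of $\mathbb{Z}_n$. Let $p$ be a prime number. Then: (1) If $n$ is even, then $$SO(G(\mathbb{Z}_n)) = \frac{n(\phi(n))^2}{\sqrt{2}}.$$ (2) If $n=p^\alpha$ with $\alpha \geq 1$ an integer and $p > 2$, then $$SO(G(\mathbb{Z}_n)) = \phi(n)(n-\phi(n))\sqrt{(\phi(n))^2 + (\phi(n)-1)^2} + \frac{\big[\phi(n)(\phi(n)-1) - (n-\phi(n))\phi(n)\big](\phi(n)-1)}{\sqrt{2}}.$$
   Context: For a finite simple graph $G$, the Sombor index is $SO(G)=\sum_{uv\in E(G)}\sqrt{d_u^2+d_v^2}$, the sum being over (unordered) edges, where $d_x$ is the degree of the vertex $x$. For a commutative ring $R$ with unity, $U(R)$ denotes the set of units of $R$. The unit graph $G(R)$ is the simple graph whose vertices are all elements of $R$, with distinct vertices $x,y$ adjacent if and only if $x+y\in U(R)$. $\mathbb{Z}_n$ is the ring of integers modulo $n$ and $\phi$ is Euler's totient function. -}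

module Defs where

open import Algebra.Bundles using (CommutativeRing)
import Algebra.Definitions as AlgDefs
open import Data.Empty using (⊥-elim)
open import Data.Fin.Base as Fin using (Fin; toℕ)
import Data.Fin.Properties as Fin
open import Data.Integer.Base as ℤ using (+_)
import Data.Integer.Properties as ℤ
open import Data.List.Base using (List; length; filter; map; foldr; allFin; cartesianProduct; upTo)
open import Data.Nat.Base as ℕ using (ℕ; zero; suc; NonZero)
import Data.Nat.Properties as ℕ
import Data.Nat.DivMod as ℕ
open import Data.Nat.Coprimality as Coprime using (coprime?)
open import Data.Product.Base using (∃-syntax; _×_; _,_; proj₁; proj₂)
open import Data.Rational.Base as ℚ using (ℚ; 0ℚ; 1ℚ; ½; ∣_∣; _⊔_; 1/_)
import Data.Rational.Properties as ℚ
import Data.Rational.Unnormalised.Base as ℚᵘ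
import Data.Rational.Unnormalised.Properties as ℚᵘ
open import Data.Rational.Solver using (module +-*-Solver)
open import Data.Sum.Base using (inj₁; inj₂)
open import Function.Bundles using (Inverse)
open import Function.Construct.Identity using (inverse)
open import Level as Level using (Level; 0ℓ)
open import Relation.Binary.Bundles using (Setoid)
open import Relation.Binary.Core using (Rel)
open import Relation.Binary.Definitions using (Decidable; Symmetric; Irreflexive; _Respects₂_)
open import Relation.Binary.PropositionalEquality
  using (_≡_; _≢_; refl; sym; trans; cong; cong₂; subst; subst₂; module ≡-Reasoning)
import Relation.Binary.PropositionalEquality as ≡
open import Relation.Nullary using (¬_; yes; no)
open import Relation.Nullary.Decidable using (_×-dec_; ¬?)

module _ where
  open +-*-Solver using (solve; _:=_; _:+_; _:*_; _:-_; :-_; con)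

  ∣∣<-both : ∀ {a b ε} → a ℚ.< b ℚ.+ ε → b ℚ.< a ℚ.+ ε → ∣ a ℚ.- b ∣ ℚ.< ε
  ∣∣<-both {a} {b} {ε} a<b+ε b<a+ε with ℚ.∣p∣≡p∨∣p∣≡-p (a ℚ.- b)
  ... | inj₁ eq = subst₂ ℚ._<_ (sym eq)
    (solve 2 (λ b e → (b :+ e) :- b := e) refl b ε) (ℚ.+-monoˡ-< (ℚ.- b) a<b+ε)
  ... | inj₂ eq = subst₂ ℚ._<_
    (trans (solve 2 (λ a b → b :- a := :- (a :- b)) refl a b) (sym eq))
    (solve 2 (λ a e → (a :+ e) :- a := e) refl a ε) (ℚ.+-monoˡ-< (ℚ.- a) b<a+ε)

  p≤∣p∣ : ∀ p → p ℚ.≤ ∣ p ∣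
  p≤∣p∣ p with ℚ.≤-total 0ℚ p
  ... | inj₁ 0≤p = ℚ.≤-reflexive (sym (ℚ.0≤p⇒∣p∣≡p 0≤p))
  ... | inj₂ p≤0 = ℚ.≤-trans p≤0 (ℚ.0≤∣p∣ p)

  ∣∣<⇒< : ∀ {a b ε} → ∣ a ℚ.- b ∣ ℚ.< ε → a ℚ.< b ℚ.+ ε
  ∣∣<⇒< {a} {b} {ε} h = subst (ℚ._< b ℚ.+ ε)
    (solve 2 (λ a b → b :+ (a :- b) := a) refl a b)
    (ℚ.+-monoʳ-< b (ℚ.≤-<-trans (p≤∣p∣ (a ℚ.- b)) h))

  ½-pos : ∀ {ε} → 0ℚ ℚ.< ε → 0ℚ ℚ.< ½ ℚ.* ε
  ½-pos {ε} 0<ε = subst (ℚ._< ½ ℚ.* ε) (ℚ.*-zeroʳ ½) (ℚ.*-monoʳ-<-pos ½ 0<ε)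

  ½+½ : ∀ ε → ½ ℚ.* ε ℚ.+ ½ ℚ.* ε ≡ ε
  ½+½ ε = solve 1 (λ e → con ½ :* e :+ con ½ :* e := e) refl ε

  +-pos : ∀ {p q} → 0ℚ ℚ.< p → 0ℚ ℚ.< q → 0ℚ ℚ.< p ℚ.+ q
  +-pos {p} {q} 0<p 0<q = ℚ.+-mono-< {0ℚ} {p} {0ℚ} {q} 0<p 0<q

  *-pos : ∀ {p q} → 0ℚ ℚ.< p → 0ℚ ℚ.< q → 0ℚ ℚ.< p ℚ.* q
  *-pos {p} {q} 0<p 0<q = subst (ℚ._< p ℚ.* q) (ℚ.*-zeroʳ p)
    (ℚ.*-monoʳ-<-pos p {{ℚ.positive 0<p}} 0<q)

  *-monoˡ-≤ : ∀ {r p q} → 0ℚ ℚ.≤ r → p ℚ.≤ q → r ℚ.* p ℚ.≤ r ℚ.* q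
  *-monoˡ-≤ {r} 0≤r = ℚ.*-monoˡ-≤-nonNeg r {{ℚ.nonNegative 0≤r}}

  *-monoʳ-≤ : ∀ {r p q} → 0ℚ ℚ.≤ r → p ℚ.≤ q → p ℚ.* r ℚ.≤ q ℚ.* r
  *-monoʳ-≤ {r} 0≤r = ℚ.*-monoʳ-≤-nonNeg r {{ℚ.nonNegative 0≤r}}

  ∣∣-triangle-< : ∀ {p q ε δ} → ∣ p ∣ ℚ.< ε → ∣ q ∣ ℚ.< δ → ∣ p ℚ.+ q ∣ ℚ.< ε ℚ.+ δ
  ∣∣-triangle-< {p} {q} h k = ℚ.≤-<-trans (ℚ.∣p+q∣≤∣p∣+∣q∣ p q) (ℚ.+-mono-< h k)

  square-cancel-≤ : ∀ {p q} → 0ℚ ℚ.≤ q → p ℚ.* p ℚ.≤ q ℚ.* q → p ℚ.≤ q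
  square-cancel-≤ {p} {q} 0≤q h with p ℚ.≤? q
  ... | yes p≤q = p≤q
  ... | no  p≰q = ⊥-elim (ℚ.<-irrefl refl (ℚ.≤-<-trans h (ℚ.≤-<-trans
          (*-monoˡ-≤ 0≤q (ℚ.<⇒≤ q<p))
          (ℚ.*-monoˡ-<-pos p {{ℚ.positive (ℚ.≤-<-trans 0≤q q<p)}} q<p))))
    where q<p = ℚ.≰⇒> p≰q

fromℕ-ℚ : ℕ → ℚ
fromℕ-ℚ k = ℚ.mkℚ (+ k) 0 (Coprime.sym (Coprime.1-coprimeTo k))

unitFrac : ℕ → ℚ
unitFrac n = ℚ.mkℚ (+ 1) n (Coprime.1-coprimeTo (suc n))

module _ where
  open ℚᵘ.≃-Reasoning

  fromℕ-ℚ≃ : ∀ k → ℚ.toℚᵘ (fromℕ-ℚ k) ℚᵘ.≃ ℚᵘ.mkℚᵘ (+ k) 0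
  fromℕ-ℚ≃ k = ℚᵘ.≃-refl

  fromℕ-ℚ-* : ∀ k l → fromℕ-ℚ (k ℕ.* l) ≡ fromℕ-ℚ k ℚ.* fromℕ-ℚ l
  fromℕ-ℚ-* k l = ℚ.toℚᵘ-injective (begin
    ℚ.toℚᵘ (fromℕ-ℚ (k ℕ.* l))                 ≈⟨ fromℕ-ℚ≃ (k ℕ.* l) ⟩
    ℚᵘ.mkℚᵘ (+ (k ℕ.* l)) 0                    ≈⟨ ℚᵘ.*≡* (cong (ℤ._* + 1) (ℤ.pos-* k l)) ⟩
    ℚᵘ.mkℚᵘ (+ k) 0 ℚᵘ.* ℚᵘ.mkℚᵘ (+ l) 0       ≈⟨ ℚᵘ.*-cong (fromℕ-ℚ≃ k) (fromℕ-ℚ≃ l) ⟨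
    ℚ.toℚᵘ (fromℕ-ℚ k) ℚᵘ.* ℚ.toℚᵘ (fromℕ-ℚ l) ≈⟨ ℚ.toℚᵘ-homo-* (fromℕ-ℚ k) (fromℕ-ℚ l) ⟨
    ℚ.toℚᵘ (fromℕ-ℚ k ℚ.* fromℕ-ℚ l)           ∎)

  fromℕ-ℚ-suc : ∀ k → fromℕ-ℚ (suc k) ≡ fromℕ-ℚ k ℚ.+ 1ℚ
  fromℕ-ℚ-suc k = ℚ.toℚᵘ-injective (begin
    ℚ.toℚᵘ (fromℕ-ℚ (suc k))             ≈⟨ fromℕ-ℚ≃ (suc k) ⟩
    ℚᵘ.mkℚᵘ (+ suc k) 0                  ≈⟨ ℚᵘ.*≡* (cong (ℤ._* + 1) eq) ⟩
    ℚᵘ.mkℚᵘ (+ k) 0 ℚᵘ.+ ℚᵘ.1ℚᵘ          ≈⟨ ℚᵘ.+-congˡ ℚᵘ.1ℚᵘ (fromℕ-ℚ≃ k) ⟨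
    ℚ.toℚᵘ (fromℕ-ℚ k) ℚᵘ.+ ℚᵘ.1ℚᵘ       ≈⟨ ℚ.toℚᵘ-homo-+ (fromℕ-ℚ k) 1ℚ ⟨
    ℚ.toℚᵘ (fromℕ-ℚ k ℚ.+ 1ℚ)            ∎)
    where
    eq : + suc k ≡ + k ℤ.* + 1 ℤ.+ + 1 ℤ.* + 1
    eq = trans (cong +_ (ℕ.+-comm 1 k)) (cong (ℤ._+ + 1) (sym (ℤ.*-identityʳ (+ k))))

  unitFrac-inverse : ∀ n → fromℕ-ℚ (suc n) ℚ.* unitFrac n ≡ 1ℚ
  unitFrac-inverse n = ℚ.toℚᵘ-injective (begin
    ℚ.toℚᵘ (fromℕ-ℚ (suc n) ℚ.* unitFrac n)            ≈⟨ ℚ.toℚᵘ-homo-* (fromℕ-ℚ (suc n)) (unitFrac n) ⟩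
    ℚ.toℚᵘ (fromℕ-ℚ (suc n)) ℚᵘ.* ℚ.toℚᵘ (unitFrac n)  ≈⟨ ℚᵘ.*-cong (fromℕ-ℚ≃ (suc n)) (ℚᵘ.≃-refl {ℚᵘ.mkℚᵘ (+ 1) n}) ⟩
    ℚᵘ.mkℚᵘ (+ suc n) 0 ℚᵘ.* ℚᵘ.mkℚᵘ (+ 1) n           ≈⟨ ℚᵘ.*≡* eq ⟩
    ℚᵘ.1ℚᵘ                                             ∎)
    where
    eq : (+ suc n ℤ.* + 1) ℤ.* + 1 ≡ + 1 ℤ.* (+ 1 ℤ.* + suc n)
    eq = trans (ℤ.*-identityʳ (+ suc n ℤ.* + 1)) (trans (ℤ.*-comm (+ suc n) (+ 1)) (sym (ℤ.*-identityˡ (+ 1 ℤ.* + suc n))))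

  fromℕ-ℚ-mono-≤ : ∀ {k l} → k ℕ.≤ l → fromℕ-ℚ k ℚ.≤ fromℕ-ℚ l
  fromℕ-ℚ-mono-≤ {k} {l} k≤l = ℚ.toℚᵘ-cancel-≤
    (ℚᵘ.≤-respˡ-≃ (ℚᵘ.≃-sym (fromℕ-ℚ≃ k)) (ℚᵘ.≤-respʳ-≃ (ℚᵘ.≃-sym (fromℕ-ℚ≃ l))
      (ℚᵘ.*≤* (ℤ.*-monoʳ-≤-nonNeg (+ 1) (ℤ.+≤+ k≤l)))))

  fromℕ-ℚ-mono-< : ∀ {k l} → k ℕ.< l → fromℕ-ℚ k ℚ.< fromℕ-ℚ l
  fromℕ-ℚ-mono-< {k} k<l = ℚ.<-≤-trans
    (subst₂ ℚ._<_ (ℚ.+-identityʳ (fromℕ-ℚ k)) (sym (fromℕ-ℚ-suc k))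
      (ℚ.+-monoʳ-< (fromℕ-ℚ k) (ℚ.positive⁻¹ 1ℚ)))
    (fromℕ-ℚ-mono-≤ k<l)

  numerator/denominator : ∀ q → 0ℚ ℚ.≤ q →
    q ℚ.* fromℕ-ℚ (ℚ.↧ₙ q) ≡ fromℕ-ℚ (ℤ.∣ ℚ.↥ q ∣)
  numerator/denominator q@record{} 0≤q = ℚ.toℚᵘ-injective (begin
    ℚ.toℚᵘ (q ℚ.* fromℕ-ℚ (ℚ.↧ₙ q))             ≈⟨ ℚ.toℚᵘ-homo-* q (fromℕ-ℚ (ℚ.↧ₙ q)) ⟩
    ℚ.toℚᵘ q ℚᵘ.* ℚ.toℚᵘ (fromℕ-ℚ (ℚ.↧ₙ q))     ≈⟨ ℚᵘ.*-congˡ {ℚ.toℚᵘ q} (fromℕ-ℚ≃ (ℚ.↧ₙ q)) ⟩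
    ℚ.toℚᵘ q ℚᵘ.* ℚᵘ.mkℚᵘ (ℚ.↧ q) 0             ≈⟨ ℚᵘ.*≡* eq ⟩
    ℚᵘ.mkℚᵘ (ℚ.↥ q) 0                           ≡⟨ cong (λ z → ℚᵘ.mkℚᵘ z 0) (ℤ.0≤i⇒+∣i∣≡i (ℤ.nonNegative⁻¹ (ℚ.↥ q) {{ℚ.nonNegative 0≤q}})) ⟨
    ℚᵘ.mkℚᵘ (+ ℤ.∣ ℚ.↥ q ∣) 0                   ≈⟨ fromℕ-ℚ≃ ℤ.∣ ℚ.↥ q ∣ ⟨
    ℚ.toℚᵘ (fromℕ-ℚ ℤ.∣ ℚ.↥ q ∣)                ∎)
    where
    eq : (ℚ.↥ q ℤ.* ℚ.↧ q) ℤ.* + 1 ≡ ℚ.↥ q ℤ.* (ℚ.↧ q ℤ.* + 1)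
    eq = ℤ.*-assoc (ℚ.↥ q) (ℚ.↧ q) (+ 1)

archimedean : ∀ {ε} → 0ℚ ℚ.< ε → ∃[ N ] (∀ n → N ℕ.≤ n → unitFrac n ℚ.< ε)
archimedean {ε} 0<ε = d , λ n d≤n → ℚ.≰⇒> λ ε≤u → ℚ.<-irrefl refl (begin-strict
    1ℚ                                ≤⟨ 1≤εd ⟩
    ε ℚ.* fromℕ-ℚ d                   <⟨ ℚ.*-monoʳ-<-pos ε {{ℚ.positive 0<ε}} (fromℕ-ℚ-mono-< (ℕ.s≤s d≤n)) ⟩
    ε ℚ.* fromℕ-ℚ (suc n)             ≤⟨ *-monoʳ-≤ (fromℕ-ℚ-mono-≤ ℕ.z≤n) ε≤u ⟩
    unitFrac n ℚ.* fromℕ-ℚ (suc n)    ≡⟨ ℚ.*-comm (unitFrac n) (fromℕ-ℚ (suc n)) ⟩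
    fromℕ-ℚ (suc n) ℚ.* unitFrac n    ≡⟨ unitFrac-inverse n ⟩
    1ℚ                                ∎)
  where
  open ℚ.≤-Reasoning
  d = ℚ.↧ₙ ε
  positive-numerator : ∀ a → 0ℚ ℚ.< fromℕ-ℚ a → 1ℚ ℚ.≤ fromℕ-ℚ a
  positive-numerator zero    0<0 = ⊥-elim (ℚ.<-irrefl refl 0<0)
  positive-numerator (suc a) _   = fromℕ-ℚ-mono-≤ {1} {suc a} (ℕ.s≤s ℕ.z≤n)
  eq = numerator/denominator ε (ℚ.<⇒≤ 0<ε)
  1≤εd : 1ℚ ℚ.≤ ε ℚ.* fromℕ-ℚ d
  1≤εd = subst (1ℚ ℚ.≤_) (sym eq) (positive-numerator _
    (subst (0ℚ ℚ.<_) eq (*-pos 0<ε (fromℕ-ℚ-mono-< {0} {d} (ℕ.s≤s ℕ.z≤n)))))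

isqrt-step : ℕ → ℕ → ℕ
isqrt-step k t with suc t ℕ.* suc t ℕ.≤? suc k
... | yes _ = suc t
... | no  _ = t

-- The largest t with t² ≤ k.
isqrt : ℕ → ℕ
isqrt zero    = zero
isqrt (suc k) = isqrt-step k (isqrt k)

isqrt-spec : ∀ k → isqrt k ℕ.* isqrt k ℕ.≤ k × k ℕ.< suc (isqrt k) ℕ.* suc (isqrt k)
isqrt-spec zero    = ℕ.z≤n , ℕ.s≤s ℕ.z≤n
isqrt-spec (suc k) = step (isqrt k) (isqrt-spec k)
  where
  step : ∀ t → t ℕ.* t ℕ.≤ k × k ℕ.< suc t ℕ.* suc t →
    isqrt-step k t ℕ.* isqrt-step k t ℕ.≤ suc k × suc k ℕ.< suc (isqrt-step k t) ℕ.* suc (isqrt-step k t)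
  step t (t²≤k , k<) with suc t ℕ.* suc t ℕ.≤? suc k
  ... | yes p = p , ℕ.≤-<-trans k< (ℕ.*-mono-< (ℕ.n<1+n (suc t)) (ℕ.n<1+n (suc t)))
  ... | no ¬p = ℕ.m≤n⇒m≤1+n t²≤k , ℕ.≰⇒> ¬p

-- For q ≥ 0, √-numerator q n is the largest t with (t/(n+1))² ≤ q;
-- negative q are replaced by 0.
√-numerator : ℚ → ℕ → ℕ
√-numerator q n =
  isqrt (ℤ.∣ ℚ.↥ (q ⊔ 0ℚ) ∣ ℕ.* (suc n ℕ.* suc n) ℕ./ ℚ.↧ₙ (q ⊔ 0ℚ))

√-approx : ℚ → ℕ → ℚ
√-approx q n = fromℕ-ℚ (√-numerator q n) ℚ.* unitFrac n

0≤unitFrac : ∀ n → 0ℚ ℚ.≤ unitFrac n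
0≤unitFrac n = ℚ.nonNegative⁻¹ (unitFrac n)

0<unitFrac : ∀ n → 0ℚ ℚ.< unitFrac n
0<unitFrac n = ℚ.positive⁻¹ (unitFrac n)

0≤√-approx : ∀ q n → 0ℚ ℚ.≤ √-approx q n
0≤√-approx q n = subst (ℚ._≤ √-approx q n) (ℚ.*-zeroˡ (unitFrac n))
  (*-monoʳ-≤ (0≤unitFrac n) (fromℕ-ℚ-mono-≤ {0} {√-numerator q n} ℕ.z≤n))

module √-approx-bounds (q : ℚ) (n : ℕ) where
  open ℚ.≤-Reasoning
  open +-*-Solver using (solve; _:=_; _:+_; _:*_; con)

  private
    r = q ⊔ 0ℚ
    a = ℤ.∣ ℚ.↥ r ∣
    d = ℚ.↧ₙ r
    M = suc n
    k = a ℕ.* (M ℕ.* M) ℕ./ d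
    t = isqrt k
    s = √-approx q n
    u = unitFrac n

    instance
      d-pos : ℚ.Positive (fromℕ-ℚ d)
      d-pos = ℚ.positive (fromℕ-ℚ-mono-< {0} {d} (ℕ.s≤s ℕ.z≤n))

    scale-r : r ℚ.* fromℕ-ℚ d ≡ fromℕ-ℚ (a ℕ.* (M ℕ.* M)) ℚ.* (u ℚ.* u)
    scale-r = begin-equality
      r ℚ.* fromℕ-ℚ d
        ≡⟨ numerator/denominator r (ℚ.p≤q⊔p q 0ℚ) ⟩
      fromℕ-ℚ a
        ≡⟨ solve 1 (λ a → a := a :* (con 1ℚ :* con 1ℚ)) refl (fromℕ-ℚ a) ⟩
      fromℕ-ℚ a ℚ.* (1ℚ ℚ.* 1ℚ)
        ≡⟨ cong (λ z → fromℕ-ℚ a ℚ.* (z ℚ.* z)) (unitFrac-inverse n) ⟨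
      fromℕ-ℚ a ℚ.* ((fromℕ-ℚ M ℚ.* u) ℚ.* (fromℕ-ℚ M ℚ.* u))
        ≡⟨ solve 3 (λ a m u → a :* ((m :* u) :* (m :* u)) := (a :* (m :* m)) :* (u :* u)) refl (fromℕ-ℚ a) (fromℕ-ℚ M) u ⟩
      (fromℕ-ℚ a ℚ.* (fromℕ-ℚ M ℚ.* fromℕ-ℚ M)) ℚ.* (u ℚ.* u)
        ≡⟨ cong (λ z → (fromℕ-ℚ a ℚ.* z) ℚ.* (u ℚ.* u)) (fromℕ-ℚ-* M M) ⟨
      (fromℕ-ℚ a ℚ.* fromℕ-ℚ (M ℕ.* M)) ℚ.* (u ℚ.* u)
        ≡⟨ cong (ℚ._* (u ℚ.* u)) (fromℕ-ℚ-* a (M ℕ.* M)) ⟨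
      fromℕ-ℚ (a ℕ.* (M ℕ.* M)) ℚ.* (u ℚ.* u) ∎

    scale-square : ∀ t → fromℕ-ℚ (t ℕ.* t ℕ.* d) ℚ.* (u ℚ.* u) ≡
                         ((fromℕ-ℚ t ℚ.* u) ℚ.* (fromℕ-ℚ t ℚ.* u)) ℚ.* fromℕ-ℚ d
    scale-square t = begin-equality
      fromℕ-ℚ (t ℕ.* t ℕ.* d) ℚ.* (u ℚ.* u)
        ≡⟨ cong (ℚ._* (u ℚ.* u)) (fromℕ-ℚ-* (t ℕ.* t) d) ⟩
      (fromℕ-ℚ (t ℕ.* t) ℚ.* fromℕ-ℚ d) ℚ.* (u ℚ.* u)
        ≡⟨ cong (λ z → (z ℚ.* fromℕ-ℚ d) ℚ.* (u ℚ.* u)) (fromℕ-ℚ-* t t) ⟩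
      ((fromℕ-ℚ t ℚ.* fromℕ-ℚ t) ℚ.* fromℕ-ℚ d) ℚ.* (u ℚ.* u)
        ≡⟨ solve 3 (λ t d u → ((t :* t) :* d) :* (u :* u) := ((t :* u) :* (t :* u)) :* d) refl (fromℕ-ℚ t) (fromℕ-ℚ d) u ⟩
      ((fromℕ-ℚ t ℚ.* u) ℚ.* (fromℕ-ℚ t ℚ.* u)) ℚ.* fromℕ-ℚ d ∎

    t²d≤ : t ℕ.* t ℕ.* d ℕ.≤ a ℕ.* (M ℕ.* M)
    t²d≤ = ℕ.≤-trans (ℕ.*-monoˡ-≤ d (proj₁ (isqrt-spec k))) (ℕ.m/n*n≤m (a ℕ.* (M ℕ.* M)) d)

    <[1+t]²d : a ℕ.* (M ℕ.* M) ℕ.< suc t ℕ.* suc t ℕ.* d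
    <[1+t]²d = ℕ.≰⇒> λ le → ℕ.<⇒≱ (proj₂ (isqrt-spec k))
      (subst (ℕ._≤ k) (ℕ.m*n/n≡m (suc t ℕ.* suc t) d) (ℕ./-monoˡ-≤ d le))

    s+u : fromℕ-ℚ (suc t) ℚ.* u ≡ s ℚ.+ u
    s+u = trans (cong (ℚ._* u) (fromℕ-ℚ-suc t))
      (solve 2 (λ t u → (t :+ con 1ℚ) :* u := t :* u :+ u) refl (fromℕ-ℚ t) u)

    u² : 0ℚ ℚ.< u ℚ.* u
    u² = *-pos (0<unitFrac n) (0<unitFrac n)

  lower : s ℚ.* s ℚ.≤ r
  lower = ℚ.*-cancelʳ-≤-pos (fromℕ-ℚ d) (begin
    s ℚ.* s ℚ.* fromℕ-ℚ d                     ≡⟨ scale-square t ⟨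
    fromℕ-ℚ (t ℕ.* t ℕ.* d) ℚ.* (u ℚ.* u)     ≤⟨ *-monoʳ-≤ (ℚ.<⇒≤ u²) (fromℕ-ℚ-mono-≤ t²d≤) ⟩
    fromℕ-ℚ (a ℕ.* (M ℕ.* M)) ℚ.* (u ℚ.* u)   ≡⟨ scale-r ⟨
    r ℚ.* fromℕ-ℚ d                           ∎)

  upper : r ℚ.< (s ℚ.+ u) ℚ.* (s ℚ.+ u)
  upper = ℚ.*-cancelʳ-<-nonNeg (fromℕ-ℚ d) {{ℚ.pos⇒nonNeg (fromℕ-ℚ d)}} (begin-strict
    r ℚ.* fromℕ-ℚ d                                   ≡⟨ scale-r ⟩
    fromℕ-ℚ (a ℕ.* (M ℕ.* M)) ℚ.* (u ℚ.* u)           <⟨ ℚ.*-monoˡ-<-pos (u ℚ.* u) {{ℚ.positive u²}} (fromℕ-ℚ-mono-< <[1+t]²d) ⟩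
    fromℕ-ℚ (suc t ℕ.* suc t ℕ.* d) ℚ.* (u ℚ.* u)     ≡⟨ scale-square (suc t) ⟩
    ((fromℕ-ℚ (suc t) ℚ.* u) ℚ.* (fromℕ-ℚ (suc t) ℚ.* u)) ℚ.* fromℕ-ℚ d
                                                      ≡⟨ cong (λ z → (z ℚ.* z) ℚ.* fromℕ-ℚ d) s+u ⟩
    ((s ℚ.+ u) ℚ.* (s ℚ.+ u)) ℚ.* fromℕ-ℚ d           ∎)

√-approx-close : ∀ {p q δ} m n → 0ℚ ℚ.< δ → p ℚ.< q ℚ.+ δ ℚ.* δ →
  √-approx p m ℚ.≤ (√-approx q n ℚ.+ unitFrac n) ℚ.+ δ
√-approx-close {p} {q} {δ} m n 0<δ p<q+δ² = square-cancel-≤ 0≤b (begin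
    s ℚ.* s                             ≤⟨ √-approx-bounds.lower p m ⟩
    p ⊔ 0ℚ                            ≤⟨ ℚ.⊔-lub p≤ 0≤ ⟩
    (q ⊔ 0ℚ) ℚ.+ δ ℚ.* δ              ≤⟨ ℚ.+-monoˡ-≤ (δ ℚ.* δ) (ℚ.<⇒≤ (√-approx-bounds.upper q n)) ⟩
    c ℚ.* c ℚ.+ δ ℚ.* δ                 ≡⟨ ℚ.+-identityʳ _ ⟨
    (c ℚ.* c ℚ.+ δ ℚ.* δ) ℚ.+ 0ℚ        ≤⟨ ℚ.+-monoʳ-≤ (c ℚ.* c ℚ.+ δ ℚ.* δ) (ℚ.+-mono-≤ 0≤cδ 0≤cδ) ⟩
    (c ℚ.* c ℚ.+ δ ℚ.* δ) ℚ.+ (c ℚ.* δ ℚ.+ c ℚ.* δ)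
      ≡⟨ solve 2 (λ c d → (c :* c :+ d :* d) :+ (c :* d :+ c :* d) := (c :+ d) :* (c :+ d)) refl c δ ⟩
    (c ℚ.+ δ) ℚ.* (c ℚ.+ δ)             ∎)
  where
  open ℚ.≤-Reasoning
  open +-*-Solver using (solve; _:=_; _:+_; _:*_)
  s = √-approx p m
  c = √-approx q n ℚ.+ unitFrac n
  0≤c : 0ℚ ℚ.≤ c
  0≤c = ℚ.+-mono-≤ (0≤√-approx q n) (0≤unitFrac n)
  0≤b : 0ℚ ℚ.≤ c ℚ.+ δ
  0≤b = ℚ.+-mono-≤ 0≤c (ℚ.<⇒≤ 0<δ)
  0≤cδ : 0ℚ ℚ.≤ c ℚ.* δ
  0≤cδ = subst (ℚ._≤ c ℚ.* δ) (ℚ.*-zeroˡ δ) (*-monoʳ-≤ (ℚ.<⇒≤ 0<δ) 0≤c)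
  p≤ : p ℚ.≤ (q ⊔ 0ℚ) ℚ.+ δ ℚ.* δ
  p≤ = ℚ.≤-trans (ℚ.<⇒≤ p<q+δ²) (ℚ.+-monoˡ-≤ (δ ℚ.* δ) (ℚ.p≤p⊔q q 0ℚ))
  0≤ : 0ℚ ℚ.≤ (q ⊔ 0ℚ) ℚ.+ δ ℚ.* δ
  0≤ = ℚ.+-mono-≤ (ℚ.p≤q⊔p q 0ℚ) (ℚ.<⇒≤ (*-pos 0<δ 0<δ))

IsCauchy : (ℕ → ℚ) → Set
IsCauchy s = ∀ ε → 0ℚ ℚ.< ε →
  ∃[ N ] (∀ m n → N ℕ.≤ m → N ℕ.≤ n → ∣ s m ℚ.- s n ∣ ℚ.< ε)

record ℝ : Set where
  constructor mkℝ
  field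
    seq    : ℕ → ℚ
    cauchy : IsCauchy seq

open ℝ public

infix  4 _≃ℝ_ _#0
infixl 6 _+ℝ_ _-ℝ_
infixl 7 _*ℝ_
infix  8 -ℝ_ √_
infix  9 _²

-- Equality of reals is this relation, not _≡_.
_≃ℝ_ : ℝ → ℝ → Set
x ≃ℝ y = ∀ ε → 0ℚ ℚ.< ε → ∃[ N ] (∀ n → N ℕ.≤ n → ∣ seq x n ℚ.- seq y n ∣ ℚ.< ε)

-- Apartness from zero, the constructive form of being nonzero.
_#0 : ℝ → Set
x #0 = ∃[ δ ] (0ℚ ℚ.< δ × ∃[ N ] (∀ n → N ℕ.≤ n → δ ℚ.≤ ∣ seq x n ∣))

fromℚ : ℚ → ℝ
fromℚ q = mkℝ (λ _ → q) λ ε 0<ε → 0 , λ _ _ _ _ →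
  subst (ℚ._< ε) (sym (cong ∣_∣ (ℚ.+-inverseʳ q))) 0<ε

fromℕ : ℕ → ℝ
fromℕ k = fromℚ (fromℕ-ℚ k)

0ℝ 1ℝ : ℝ
0ℝ = fromℕ 0
1ℝ = fromℕ 1

_+ℝ_ : ℝ → ℝ → ℝ
x +ℝ y = mkℝ (λ n → seq x n ℚ.+ seq y n) λ ε 0<ε →
  let N₁ , h₁ = cauchy x (½ ℚ.* ε) (½-pos 0<ε)
      N₂ , h₂ = cauchy y (½ ℚ.* ε) (½-pos 0<ε)
  in N₁ ℕ.⊔ N₂ , λ m n m≥ n≥ → subst₂ ℚ._<_
       (cong ∣_∣ (solve 4 (λ a b c d → (a :- b) :+ (c :- d) := (a :+ c) :- (b :+ d)) refl
                    (seq x m) (seq x n) (seq y m) (seq y n)))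
       (½+½ ε)
       (∣∣-triangle-< (h₁ m n (ℕ.m⊔n≤o⇒m≤o N₁ N₂ m≥) (ℕ.m⊔n≤o⇒m≤o N₁ N₂ n≥))
                      (h₂ m n (ℕ.m⊔n≤o⇒n≤o N₁ N₂ m≥) (ℕ.m⊔n≤o⇒n≤o N₁ N₂ n≥)))
  where open +-*-Solver using (solve; _:=_; _:+_; _:-_)

-ℝ_ : ℝ → ℝ
-ℝ x = mkℝ (λ n → ℚ.- seq x n) λ ε 0<ε →
  let N , h = cauchy x ε 0<ε
  in N , λ m n m≥ n≥ → subst (ℚ._< ε)
       (trans (sym (ℚ.∣-p∣≡∣p∣ (seq x m ℚ.- seq x n)))
              (cong ∣_∣ (solve 2 (λ a b → :- (a :- b) := :- a :- (:- b)) refl (seq x m) (seq x n))))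
       (h m n m≥ n≥)
  where open +-*-Solver using (solve; _:=_; _:-_; :-_)

_-ℝ_ : ℝ → ℝ → ℝ
x -ℝ y = x +ℝ (-ℝ y)

EventuallyBounded : (ℕ → ℚ) → Set
EventuallyBounded s = ∃[ B ] (0ℚ ℚ.< B × ∃[ N ] (∀ n → N ℕ.≤ n → ∣ s n ∣ ℚ.≤ B))

eventually-bounded : ∀ x → EventuallyBounded (seq x)
eventually-bounded x = go (cauchy x 1ℚ (ℚ.positive⁻¹ 1ℚ))
  where
  open ℚ.≤-Reasoning
  open +-*-Solver using (solve; _:=_; _:+_; _:-_)
  go : ∃[ N ] (∀ m n → N ℕ.≤ m → N ℕ.≤ n → ∣ seq x m ℚ.- seq x n ∣ ℚ.< 1ℚ) → EventuallyBounded (seq x)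
  go (N , h) = 1ℚ ℚ.+ ∣ seq x N ∣ , ℚ.+-mono-<-≤ (ℚ.positive⁻¹ 1ℚ) (ℚ.0≤∣p∣ (seq x N)) , N , λ n n≥ → begin
    ∣ seq x n ∣                                   ≡⟨ cong ∣_∣ (solve 2 (λ a b → a := (a :- b) :+ b) refl (seq x n) (seq x N)) ⟩
    ∣ (seq x n ℚ.- seq x N) ℚ.+ seq x N ∣         ≤⟨ ℚ.∣p+q∣≤∣p∣+∣q∣ (seq x n ℚ.- seq x N) (seq x N) ⟩
    ∣ seq x n ℚ.- seq x N ∣ ℚ.+ ∣ seq x N ∣       ≤⟨ ℚ.+-monoˡ-≤ ∣ seq x N ∣ (ℚ.<⇒≤ (h n N n≥ ℕ.≤-refl)) ⟩
    1ℚ ℚ.+ ∣ seq x N ∣                            ∎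

divide : ∀ C ε → 0ℚ ℚ.< C → 0ℚ ℚ.< ε → ∃[ δ ] (0ℚ ℚ.< δ × C ℚ.* δ ≡ ε)
divide C ε 0<C 0<ε = 1/C ℚ.* ε , *-pos (ℚ.positive⁻¹ 1/C {{ℚ.1/pos⇒pos C}}) 0<ε ,
  trans (sym (ℚ.*-assoc C 1/C ε)) (trans (cong (ℚ._* ε) (ℚ.*-inverseʳ C)) (ℚ.*-identityˡ ε))
  where
  instance
    C-pos : ℚ.Positive C
    C-pos = ℚ.positive 0<C
    C-nonZero : ℚ.NonZero C
    C-nonZero = ℚ.pos⇒nonZero C
  1/C = 1/ C

_*ℝ_ : ℝ → ℝ → ℝ
x *ℝ y = mkℝ (λ n → seq x n ℚ.* seq y n) (λ ε 0<ε →
  cauchy-* ε 0<ε (eventually-bounded x) (eventually-bounded y))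
  where
  open ℚ.≤-Reasoning
  open +-*-Solver using (solve; _:=_; _:+_; _:*_; _:-_)
  CloseBy : ℚ → Set
  CloseBy ε = ∃[ N ] (∀ m n → N ℕ.≤ m → N ℕ.≤ n →
    ∣ seq x m ℚ.* seq y m ℚ.- seq x n ℚ.* seq y n ∣ ℚ.< ε)
  bounded-* : ∀ ε A B → 0ℚ ℚ.< A → 0ℚ ℚ.< B →
    ∃[ N ] (∀ n → N ℕ.≤ n → ∣ seq x n ∣ ℚ.≤ A) → ∃[ N ] (∀ n → N ℕ.≤ n → ∣ seq y n ∣ ℚ.≤ B) →
    ∃[ δ ] (0ℚ ℚ.< δ × (A ℚ.+ B) ℚ.* δ ≡ ε) → CloseBy ε
  bounded-* ε A B 0<A 0<B (N₁ , h₁) (N₂ , h₂) (δ , 0<δ , Cδ≡ε) = N , close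
    where
    cx = cauchy x δ 0<δ
    cy = cauchy y δ 0<δ
    N₁₂ = N₁ ℕ.⊔ N₂
    N₃₄ = proj₁ cx ℕ.⊔ proj₁ cy
    N = N₁₂ ℕ.⊔ N₃₄
    prod-< : ∀ p q b → 0ℚ ℚ.< b → ∣ p ∣ ℚ.≤ b → ∣ q ∣ ℚ.< δ → ∣ p ℚ.* q ∣ ℚ.< b ℚ.* δ
    prod-< p q b 0<b p≤b q<δ = begin-strict
      ∣ p ℚ.* q ∣         ≡⟨ ℚ.∣p*q∣≡∣p∣*∣q∣ p q ⟩
      ∣ p ∣ ℚ.* ∣ q ∣     ≤⟨ *-monoʳ-≤ {∣ q ∣} {∣ p ∣} {b} (ℚ.0≤∣p∣ q) p≤b ⟩
      b ℚ.* ∣ q ∣         <⟨ ℚ.*-monoʳ-<-pos b {{ℚ.positive 0<b}} {∣ q ∣} {δ} q<δ ⟩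
      b ℚ.* δ             ∎
    close : ∀ m n → N ℕ.≤ m → N ℕ.≤ n →
      ∣ seq x m ℚ.* seq y m ℚ.- seq x n ℚ.* seq y n ∣ ℚ.< ε
    close m n m≥ n≥ = begin-strict
      ∣ a ℚ.* c ℚ.- b ℚ.* d ∣
        ≡⟨ cong ∣_∣ (solve 4 (λ a b c d → a :* c :- b :* d := a :* (c :- d) :+ d :* (a :- b)) refl a b c d) ⟩
      ∣ a ℚ.* (c ℚ.- d) ℚ.+ d ℚ.* (a ℚ.- b) ∣
        <⟨ ∣∣-triangle-< {a ℚ.* (c ℚ.- d)} {d ℚ.* (a ℚ.- b)} {A ℚ.* δ} {B ℚ.* δ} first second ⟩
      A ℚ.* δ ℚ.+ B ℚ.* δ
        ≡⟨ ℚ.*-distribʳ-+ δ A B ⟨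
      (A ℚ.+ B) ℚ.* δ
        ≡⟨ Cδ≡ε ⟩
      ε ∎
      where
      a = seq x m
      b = seq x n
      c = seq y m
      d = seq y n
      m₁₂ = ℕ.m⊔n≤o⇒m≤o N₁₂ N₃₄ m≥
      m₃₄ = ℕ.m⊔n≤o⇒n≤o N₁₂ N₃₄ m≥
      n₁₂ = ℕ.m⊔n≤o⇒m≤o N₁₂ N₃₄ n≥
      n₃₄ = ℕ.m⊔n≤o⇒n≤o N₁₂ N₃₄ n≥
      first = prod-< a (c ℚ.- d) A 0<A (h₁ m (ℕ.m⊔n≤o⇒m≤o N₁ N₂ m₁₂))
        (proj₂ cy m n (ℕ.m⊔n≤o⇒n≤o (proj₁ cx) (proj₁ cy) m₃₄) (ℕ.m⊔n≤o⇒n≤o (proj₁ cx) (proj₁ cy) n₃₄))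
      second = prod-< d (a ℚ.- b) B 0<B (h₂ n (ℕ.m⊔n≤o⇒n≤o N₁ N₂ n₁₂))
        (proj₂ cx m n (ℕ.m⊔n≤o⇒m≤o (proj₁ cx) (proj₁ cy) m₃₄) (ℕ.m⊔n≤o⇒m≤o (proj₁ cx) (proj₁ cy) n₃₄))
  cauchy-* : ∀ ε → 0ℚ ℚ.< ε → EventuallyBounded (seq x) → EventuallyBounded (seq y) → CloseBy ε
  cauchy-* ε 0<ε (A , 0<A , bx) (B , 0<B , by) =
    bounded-* ε A B 0<A 0<B bx by (divide (A ℚ.+ B) ε (+-pos {A} {B} 0<A 0<B) 0<ε)

_² : ℝ → ℝ
x ² = x *ℝ x

recip : ℚ → ℚ
recip q with q ℚ.≟ 0ℚ
... | yes _   = 0ℚ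
... | no  q≢0 = (1/ q) {{ℚ.≢-nonZero q≢0}}

recip-inverse : ∀ {q} → q ≢ 0ℚ → recip q ℚ.* q ≡ 1ℚ
recip-inverse {q} q≢0 with q ℚ.≟ 0ℚ
... | yes q≡0  = ⊥-elim (q≢0 q≡0)
... | no  q≢0′ = ℚ.*-inverseˡ q {{ℚ.≢-nonZero q≢0′}}

infix 8 _⁻¹⟨_⟩
infixl 7 _/ℝ_⟨_⟩

_⁻¹⟨_⟩ : (x : ℝ) → x #0 → ℝ
x ⁻¹⟨ δ , 0<δ , N₁ , far ⟩ = mkℝ (λ n → recip (seq x n)) cauchy-⁻¹
  where
  open ℚ.≤-Reasoning
  open +-*-Solver using (solve; _:=_; _:*_; _:-_; con)
  nonzero : ∀ n → N₁ ℕ.≤ n → seq x n ≢ 0ℚ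
  nonzero n n≥ eq = ℚ.<-irrefl refl (ℚ.<-≤-trans 0<δ (subst (λ z → δ ℚ.≤ ∣ z ∣) eq (far n n≥)))
  0<δδ : 0ℚ ℚ.< δ ℚ.* δ
  0<δδ = *-pos 0<δ 0<δ
  instance
    δδ-pos : ℚ.Positive (δ ℚ.* δ)
    δδ-pos = ℚ.positive 0<δδ
    δδ-nonNeg : ℚ.NonNegative (δ ℚ.* δ)
    δδ-nonNeg = ℚ.pos⇒nonNeg (δ ℚ.* δ)
  cauchy-⁻¹ : IsCauchy (λ n → recip (seq x n))
  cauchy-⁻¹ ε 0<ε = go (cauchy x (ε ℚ.* (δ ℚ.* δ)) (*-pos 0<ε 0<δδ))
    where
    go : ∃[ N ] (∀ m n → N ℕ.≤ m → N ℕ.≤ n → ∣ seq x m ℚ.- seq x n ∣ ℚ.< ε ℚ.* (δ ℚ.* δ)) →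
         ∃[ N ] (∀ m n → N ℕ.≤ m → N ℕ.≤ n → ∣ recip (seq x m) ℚ.- recip (seq x n) ∣ ℚ.< ε)
    go (N₂ , h) = N₁ ℕ.⊔ N₂ , close
     where
     close : ∀ m n → N₁ ℕ.⊔ N₂ ℕ.≤ m → N₁ ℕ.⊔ N₂ ℕ.≤ n → ∣ recip (seq x m) ℚ.- recip (seq x n) ∣ ℚ.< ε
     close m n m≥ n≥ = ℚ.*-cancelʳ-<-nonNeg (δ ℚ.* δ) (begin-strict
       ∣ a′ ℚ.- b′ ∣ ℚ.* (δ ℚ.* δ)         ≤⟨ *-monoˡ-≤ (ℚ.0≤∣p∣ (a′ ℚ.- b′)) δδ≤ ⟩
       ∣ a′ ℚ.- b′ ∣ ℚ.* ∣ a ℚ.* b ∣       ≡⟨ ℚ.∣p*q∣≡∣p∣*∣q∣ (a′ ℚ.- b′) (a ℚ.* b) ⟨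
       ∣ (a′ ℚ.- b′) ℚ.* (a ℚ.* b) ∣       ≡⟨ cong ∣_∣ diff ⟩
       ∣ b ℚ.- a ∣                         <⟨ h n m (ℕ.m⊔n≤o⇒n≤o N₁ N₂ n≥) (ℕ.m⊔n≤o⇒n≤o N₁ N₂ m≥) ⟩
       ε ℚ.* (δ ℚ.* δ)                     ∎)
       where
       a  = seq x m
       b  = seq x n
       a′ = recip a
       b′ = recip b
       m≥N₁ = ℕ.m⊔n≤o⇒m≤o N₁ N₂ m≥
       n≥N₁ = ℕ.m⊔n≤o⇒m≤o N₁ N₂ n≥
       δδ≤ : δ ℚ.* δ ℚ.≤ ∣ a ℚ.* b ∣
       δδ≤ = begin
         δ ℚ.* δ             ≤⟨ *-monoˡ-≤ (ℚ.<⇒≤ 0<δ) (far n n≥N₁) ⟩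
         δ ℚ.* ∣ b ∣         ≤⟨ *-monoʳ-≤ (ℚ.0≤∣p∣ b) (far m m≥N₁) ⟩
         ∣ a ∣ ℚ.* ∣ b ∣     ≡⟨ ℚ.∣p*q∣≡∣p∣*∣q∣ a b ⟨
         ∣ a ℚ.* b ∣         ∎
       diff : (a′ ℚ.- b′) ℚ.* (a ℚ.* b) ≡ b ℚ.- a
       diff = begin-equality
         (a′ ℚ.- b′) ℚ.* (a ℚ.* b)
           ≡⟨ solve 4 (λ a b a′ b′ → (a′ :- b′) :* (a :* b) := (a′ :* a) :* b :- (b′ :* b) :* a) refl a b a′ b′ ⟩
         (a′ ℚ.* a) ℚ.* b ℚ.- (b′ ℚ.* b) ℚ.* a
           ≡⟨ cong₂ (λ z w → z ℚ.* b ℚ.- w ℚ.* a) (recip-inverse (nonzero m m≥N₁)) (recip-inverse (nonzero n n≥N₁)) ⟩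
         1ℚ ℚ.* b ℚ.- 1ℚ ℚ.* a
           ≡⟨ solve 2 (λ a b → con 1ℚ :* b :- con 1ℚ :* a := b :- a) refl a b ⟩
         b ℚ.- a ∎

_/ℝ_⟨_⟩ : (x y : ℝ) → y #0 → ℝ
x /ℝ y ⟨ y#0 ⟩ = x *ℝ (y ⁻¹⟨ y#0 ⟩)

-- The square root, with value 0 on negative reals.
√_ : ℝ → ℝ
√ x = mkℝ (λ n → √-approx (seq x n) n) cauchy-√
  where
  open ℚ.≤-Reasoning
  open +-*-Solver using (solve; _:=_; _:+_)
  cauchy-√ : IsCauchy (λ n → √-approx (seq x n) n)
  cauchy-√ ε 0<ε = go (archimedean (½-pos 0<ε)) (cauchy x (½ε ℚ.* ½ε) (*-pos (½-pos 0<ε) (½-pos 0<ε)))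
   where
   ½ε = ½ ℚ.* ε
   go : ∃[ N ] (∀ n → N ℕ.≤ n → unitFrac n ℚ.< ½ε) →
        ∃[ N ] (∀ m n → N ℕ.≤ m → N ℕ.≤ n → ∣ seq x m ℚ.- seq x n ∣ ℚ.< ½ε ℚ.* ½ε) →
        ∃[ N ] (∀ m n → N ℕ.≤ m → N ℕ.≤ n → ∣ √-approx (seq x m) m ℚ.- √-approx (seq x n) n ∣ ℚ.< ε)
   go (N₁ , small) (N₂ , h) = N₁ ℕ.⊔ N₂ , λ m n m≥ n≥ →
       ∣∣<-both {√-approx (seq x m) m} {√-approx (seq x n) n} {ε} (one-sided m n m≥ n≥) (one-sided n m n≥ m≥)
    where
    one-sided : ∀ m n → N₁ ℕ.⊔ N₂ ℕ.≤ m → N₁ ℕ.⊔ N₂ ℕ.≤ n →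
      √-approx (seq x m) m ℚ.< √-approx (seq x n) n ℚ.+ ε
    one-sided m n m≥ n≥ = begin-strict
      √-approx (seq x m) m
        ≤⟨ √-approx-close {seq x m} {seq x n} {½ε} m n (½-pos 0<ε) (∣∣<⇒< {seq x m} {seq x n} (h m n (ℕ.m⊔n≤o⇒n≤o N₁ N₂ m≥) (ℕ.m⊔n≤o⇒n≤o N₁ N₂ n≥))) ⟩
      (√-approx (seq x n) n ℚ.+ unitFrac n) ℚ.+ ½ ℚ.* ε
        ≡⟨ ℚ.+-assoc (√-approx (seq x n) n) (unitFrac n) (½ ℚ.* ε) ⟩
      √-approx (seq x n) n ℚ.+ (unitFrac n ℚ.+ ½ ℚ.* ε)
        <⟨ ℚ.+-monoʳ-< (√-approx (seq x n) n) (ℚ.+-monoˡ-< (½ ℚ.* ε) (small n (ℕ.m⊔n≤o⇒m≤o N₁ N₂ n≥))) ⟩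
      √-approx (seq x n) n ℚ.+ (½ ℚ.* ε ℚ.+ ½ ℚ.* ε)
        ≡⟨ cong (√-approx (seq x n) n ℚ.+_) (½+½ ε) ⟩
      √-approx (seq x n) n ℚ.+ ε ∎

√2#0 : √ fromℕ 2 #0
√2#0 = ½ , ℚ.positive⁻¹ ½ , go (archimedean (ℚ.positive⁻¹ ½))
  where
  two = fromℕ-ℚ 2
  go : ∃[ N ] (∀ n → N ℕ.≤ n → unitFrac n ℚ.< ½) → ∃[ N ] (∀ n → N ℕ.≤ n → ½ ℚ.≤ ∣ √-approx two n ∣)
  go (N , small) = N , λ n n≥ → ℚ.≮⇒≥ λ s<½ →
    let s = √-approx two n
        u = unitFrac n
        s+u≤1 : s ℚ.+ u ℚ.≤ 1ℚ
        s+u≤1 = ℚ.<⇒≤ (ℚ.+-mono-< {s} {½} {u} {½} (ℚ.≤-<-trans (p≤∣p∣ s) s<½) (small n n≥))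
        0≤s+u : 0ℚ ℚ.≤ s ℚ.+ u
        0≤s+u = ℚ.+-mono-≤ {0ℚ} {s} {0ℚ} {u} (0≤√-approx two n) (0≤unitFrac n)
        2<1 : two ℚ.< 1ℚ
        2<1 = ℚ.<-≤-trans (√-approx-bounds.upper two n)
          (ℚ.≤-trans (*-monoˡ-≤ {s ℚ.+ u} {s ℚ.+ u} {1ℚ} 0≤s+u s+u≤1)
            (subst (ℚ._≤ 1ℚ) (sym (ℚ.*-identityʳ (s ℚ.+ u))) s+u≤1))
    in ℚ.<-asym 2<1 (fromℕ-ℚ-mono-< {1} {2} (ℕ.n<1+n 1))

sumℝ : List ℝ → ℝ
sumℝ = foldr _+ℝ_ 0ℝ

record SimpleGraph (c ℓ a : Level) : Set (Level.suc (c Level.⊔ ℓ Level.⊔ a)) where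
  field
    vertices : Setoid c ℓ
  open Setoid vertices renaming (Carrier to Vertex) using (_≈_) public
  field
    Adj        : Rel Vertex a
    Adj-resp   : Adj Respects₂ _≈_
    Adj-sym    : Symmetric Adj
    Adj-irrefl : Irreflexive _≈_ Adj

-- The enumeration lists every vertex exactly once; it fixes a summation order
-- for SO but does not affect its value up to ≃ℝ.
record IsFinite {c ℓ a} (G : SimpleGraph c ℓ a) : Set (c Level.⊔ ℓ Level.⊔ a) where
  open SimpleGraph G
  field
    order       : ℕ
    enumeration : Inverse (≡.setoid (Fin order)) vertices
    adj?        : Decidable Adj

  vertex : Fin order → Vertex
  vertex = Inverse.to enumeration

module _ {c ℓ a} (G : SimpleGraph c ℓ a) (fin : IsFinite G) where
  open SimpleGraph G
  open IsFinite fin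

  degree : Vertex → ℕ
  degree v = length (filter (λ i → adj? v (vertex i)) (allFin order))

  -- Each unordered edge is listed once, its endpoints in the order of the enumeration.
  edges : List (Fin order × Fin order)
  edges = filter (λ (i , j) → i Fin.<? j ×-dec adj? (vertex i) (vertex j))
                 (cartesianProduct (allFin order) (allFin order))

  SO : ℝ
  SO = sumℝ (map (λ (i , j) → √ (fromℕ (degree (vertex i)) ² +ℝ fromℕ (degree (vertex j)) ²)) edges)

module _ {c ℓ} (R : CommutativeRing c ℓ) where
  open CommutativeRing R

  IsUnit : Carrier → Set (c Level.⊔ ℓ)
  IsUnit = AlgDefs.Invertible _≈_ 1# _*_

  private
    IsUnit-resp : ∀ {x y} → x ≈ y → IsUnit x → IsUnit y
    IsUnit-resp x≈y (z , zx≈1 , xz≈1) = z ,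
      (≈-trans (*-cong ≈-refl (≈-sym x≈y)) zx≈1) , (≈-trans (*-cong (≈-sym x≈y) ≈-refl) xz≈1)
      where open CommutativeRing R using () renaming (refl to ≈-refl; sym to ≈-sym; trans to ≈-trans)

  unitGraph : SimpleGraph c ℓ (c Level.⊔ ℓ)
  unitGraph = record
    { vertices   = setoid
    ; Adj        = λ x y → ¬ (x ≈ y) × IsUnit (x + y)
    ; Adj-resp   = (λ y≈z (x≉y , u) → (λ x≈z → x≉y (≈-trans x≈z (≈-sym y≈z))) , IsUnit-resp (+-cong ≈-refl y≈z) u)
                 , (λ x≈z (x≉y , u) → (λ z≈y → x≉y (≈-trans x≈z z≈y)) , IsUnit-resp (+-cong x≈z ≈-refl) u)
    ; Adj-sym    = λ (x≉y , u) → (λ y≈x → x≉y (≈-sym y≈x)) , IsUnit-resp (+-comm _ _) u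
    ; Adj-irrefl = λ x≈y (x≉y , _) → x≉y x≈y
    }
    where open CommutativeRing R using () renaming (refl to ≈-refl; sym to ≈-sym; trans to ≈-trans)

module _ (n : ℕ) .{{_ : NonZero n}} where
  open ≡-Reasoning

  private
    infixl 6 _⊕_
    infixl 7 _⊗_

    _⊕_ _⊗_ : Fin n → Fin n → Fin n
    x ⊕ y = (toℕ x ℕ.+ toℕ y) ℕ.mod n
    x ⊗ y = (toℕ x ℕ.* toℕ y) ℕ.mod n

    ⊖_ : Fin n → Fin n
    ⊖ x = (n ℕ.∸ toℕ x) ℕ.mod n

    toℕ-mod : ∀ k → toℕ (k ℕ.mod n) ≡ k ℕ.% n
    toℕ-mod k = Fin.toℕ-fromℕ< (ℕ.m%n<n k n)

    mod-cong : ∀ {k l} → k ℕ.% n ≡ l ℕ.% n → k ℕ.mod n ≡ l ℕ.mod n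
    mod-cong {k} {l} eq = Fin.toℕ-injective (trans (toℕ-mod k) (trans eq (sym (toℕ-mod l))))

    mod-toℕ : ∀ x → toℕ x ℕ.mod n ≡ x
    mod-toℕ x = Fin.toℕ-injective (trans (toℕ-mod (toℕ x)) (ℕ.m<n⇒m%n≡m (Fin.toℕ<n x)))

    mod-+ : ∀ k l → (k ℕ.mod n) ⊕ (l ℕ.mod n) ≡ (k ℕ.+ l) ℕ.mod n
    mod-+ k l = mod-cong (trans (cong₂ (λ a b → (a ℕ.+ b) ℕ.% n) (toℕ-mod k) (toℕ-mod l)) (sym (ℕ.%-distribˡ-+ k l n)))

    mod-* : ∀ k l → (k ℕ.mod n) ⊗ (l ℕ.mod n) ≡ (k ℕ.* l) ℕ.mod n
    mod-* k l = mod-cong (trans (cong₂ (λ a b → (a ℕ.* b) ℕ.% n) (toℕ-mod k) (toℕ-mod l)) (sym (ℕ.%-distribˡ-* k l n)))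

    mod-+ˡ : ∀ k y → (k ℕ.mod n) ⊕ y ≡ (k ℕ.+ toℕ y) ℕ.mod n
    mod-+ˡ k y = trans (cong ((k ℕ.mod n) ⊕_) (sym (mod-toℕ y))) (mod-+ k (toℕ y))

    mod-+ʳ : ∀ x l → x ⊕ (l ℕ.mod n) ≡ (toℕ x ℕ.+ l) ℕ.mod n
    mod-+ʳ x l = trans (cong (_⊕ (l ℕ.mod n)) (sym (mod-toℕ x))) (mod-+ (toℕ x) l)

    mod-*ˡ : ∀ k y → (k ℕ.mod n) ⊗ y ≡ (k ℕ.* toℕ y) ℕ.mod n
    mod-*ˡ k y = trans (cong ((k ℕ.mod n) ⊗_) (sym (mod-toℕ y))) (mod-* k (toℕ y))

    mod-*ʳ : ∀ x l → x ⊗ (l ℕ.mod n) ≡ (toℕ x ℕ.* l) ℕ.mod n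
    mod-*ʳ x l = trans (cong (_⊗ (l ℕ.mod n)) (sym (mod-toℕ x))) (mod-* (toℕ x) l)

    ⊕-comm : ∀ x y → x ⊕ y ≡ y ⊕ x
    ⊕-comm x y = cong (ℕ._mod n) (ℕ.+-comm (toℕ x) (toℕ y))

    ⊗-comm : ∀ x y → x ⊗ y ≡ y ⊗ x
    ⊗-comm x y = cong (ℕ._mod n) (ℕ.*-comm (toℕ x) (toℕ y))

    ⊕-assoc : ∀ x y z → (x ⊕ y) ⊕ z ≡ x ⊕ (y ⊕ z)
    ⊕-assoc x y z = trans (mod-+ˡ _ z)
      (trans (cong (ℕ._mod n) (ℕ.+-assoc (toℕ x) (toℕ y) (toℕ z))) (sym (mod-+ʳ x _)))

    ⊗-assoc : ∀ x y z → (x ⊗ y) ⊗ z ≡ x ⊗ (y ⊗ z)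
    ⊗-assoc x y z = trans (mod-*ˡ _ z)
      (trans (cong (ℕ._mod n) (ℕ.*-assoc (toℕ x) (toℕ y) (toℕ z))) (sym (mod-*ʳ x _)))

    ⊕-identityˡ : ∀ x → (0 ℕ.mod n) ⊕ x ≡ x
    ⊕-identityˡ x = trans (mod-+ˡ 0 x) (mod-toℕ x)

    ⊗-identityˡ : ∀ x → (1 ℕ.mod n) ⊗ x ≡ x
    ⊗-identityˡ x = trans (mod-*ˡ 1 x) (trans (cong (ℕ._mod n) (ℕ.*-identityˡ (toℕ x))) (mod-toℕ x))

    ⊖-inverseˡ : ∀ x → (⊖ x) ⊕ x ≡ 0 ℕ.mod n
    ⊖-inverseˡ x = trans (mod-+ˡ _ x) (mod-cong (begin
      (n ℕ.∸ toℕ x ℕ.+ toℕ x) ℕ.% n   ≡⟨ cong (ℕ._% n) (ℕ.m∸n+n≡m (ℕ.<⇒≤ (Fin.toℕ<n x))) ⟩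
      n ℕ.% n                         ≡⟨ ℕ.n%n≡0 n ⟩
      0                               ≡⟨ ℕ.m*n%n≡0 0 n ⟨
      0 ℕ.% n                         ∎))

    ⊗-distribʳ-⊕ : ∀ x y z → (y ⊕ z) ⊗ x ≡ (y ⊗ x) ⊕ (z ⊗ x)
    ⊗-distribʳ-⊕ x y z = trans (mod-*ˡ _ x)
      (trans (cong (ℕ._mod n) (ℕ.*-distribʳ-+ (toℕ x) (toℕ y) (toℕ z))) (sym (mod-+ _ _)))

    comm⇒ʳ : ∀ {e} (_∙_ : Fin n → Fin n → Fin n) → (∀ x y → x ∙ y ≡ y ∙ x) → (∀ x → e ∙ x ≡ x) → ∀ x → x ∙ e ≡ x
    comm⇒ʳ {e} _∙_ comm idˡ x = trans (comm x e) (idˡ x)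

  -- Residue classes are represented by 0, …, n-1.
  ℤmod : CommutativeRing 0ℓ 0ℓ
  ℤmod = record
    { Carrier = Fin n
    ; _≈_ = _≡_
    ; _+_ = _⊕_
    ; _*_ = _⊗_
    ; -_  = ⊖_
    ; 0#  = 0 ℕ.mod n
    ; 1#  = 1 ℕ.mod n
    ; isCommutativeRing = record
      { isRing = record
        { +-isAbelianGroup = record
          { isGroup = record
            { isMonoid = record
              { isSemigroup = record
                { isMagma = record { isEquivalence = ≡.isEquivalence ; ∙-cong = cong₂ _⊕_ }
                ; assoc = ⊕-assoc
                }
              ; identity = ⊕-identityˡ , comm⇒ʳ _⊕_ ⊕-comm ⊕-identityˡ
              }
            ; inverse = ⊖-inverseˡ , λ x → trans (⊕-comm x (⊖ x)) (⊖-inverseˡ x)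
            ; ⁻¹-cong = cong ⊖_
            }
          ; comm = ⊕-comm
          }
        ; *-cong = cong₂ _⊗_
        ; *-assoc = ⊗-assoc
        ; *-identity = ⊗-identityˡ , comm⇒ʳ _⊗_ ⊗-comm ⊗-identityˡ
        ; distrib = (λ x y z → trans (⊗-comm x (y ⊕ z))
                      (trans (⊗-distribʳ-⊕ x y z) (cong₂ _⊕_ (⊗-comm y x) (⊗-comm z x))))
                  , ⊗-distribʳ-⊕
        }
      ; *-comm = ⊗-comm
      }
    }

  unitGraph-ℤmod-finite : IsFinite (unitGraph ℤmod)
  unitGraph-ℤmod-finite = record
    { order       = n
    ; enumeration = inverse (≡.setoid (Fin n))
    ; adj?        = λ x y → ¬? (x Fin.≟ y) ×-dec
        Fin.any? (λ z → (z ⊗ (x ⊕ y) Fin.≟ 1 ℕ.mod n) ×-dec ((x ⊕ y) ⊗ z Fin.≟ 1 ℕ.mod n))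
    }

φ : ℕ → ℕ
φ n = length (filter (λ k → coprime? k n) (map suc (upTo n)))

{-# OPTIONS --safe #-}
module Submission where

-- In ℤ/n the vertex i has degree Φ − [2i is a unit], since i + j runs over all
-- residues with j and only j = i is excluded.  Summing edge weights over ordered
-- pairs gives 2·SO = Σᵢⱼ Aᵢⱼ w(dᵢ, dⱼ).  If n is even, 2i is never a unit and the
-- graph is Φ-regular.  If n is a power of an odd prime, 2i is a unit iff i is, and
-- the nonunits form an ideal, so no two of them are adjacent; hence every weight is
-- w₁ plus w₂ − w₁ for each nonunit endpoint, where w₁ is the weight of an edge between
-- units and w₂ that of a mixed edge, and the double sum is computed from the degrees.
-- All this is exact rational arithmetic at each index of the Cauchy sequences; only
-- √(2a²)·√2 = 2a, which turns w₁ into a multiple of 1/√2, needs a limit.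

open import Algebra.Bundles using (CommutativeRing)
open import Data.Bool.Base using (if_then_else_)
open import Data.Fin.Base as Fin using (Fin; toℕ)
import Data.Fin.Properties as Fin
open import Data.List.Base
  using (List; []; _∷_; _++_; length; filter; map; allFin; tabulate; applyUpTo; upTo; cartesianProduct)
open import Data.List.Properties using (map-upTo)
open import Data.Nat using (ℕ; zero; suc; NonZero; _≤_; _<_; _^_)
import Data.Nat.Base as ℕ
import Data.Nat.Properties as ℕ
open import Data.Nat.Coprimality as Coprimality using (Coprime; coprime?; coprime-Bézout; coprime-+; coprime-divisor)
open import Data.Nat.GCD using (module Bézout)
import Data.Nat.DivMod as ℕ
open import Data.Nat.Divisibility as ∣ using (_∣_)
open import Data.Nat.Primality using (Prime; euclidsLemma; prime⇒irreducible; ¬prime[1])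
open import Data.Sum.Base using (inj₁; inj₂)
open import Data.Product using (_×_; _,_; proj₁; proj₂; ∃-syntax)
open import Data.Rational.Base as ℚ using (ℚ; 0ℚ; 1ℚ; ½; ∣_∣)
import Data.Rational.Properties as ℚ
open import Data.Rational.Solver using (module +-*-Solver)
open import Level using (Level)
open import Function.Base using (_∘_; id)
open import Function.Bundles using (_⇔_; mk⇔; Equivalence)
open import Relation.Binary.Definitions using (tri<; tri≈; tri>)
open import Relation.Binary.PropositionalEquality
  using (_≡_; _≢_; refl; sym; trans; cong; cong₂; subst; subst₂; module ≡-Reasoning)
open import Relation.Nullary using (¬_; Dec; yes; no; does; contradiction)
open import Relation.Nullary.Decidable using (_×-dec_; does-⇔; dec-true; dec-false)
open import Relation.Unary using (Pred; Decidable)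
open import Defs

open import Algebra.Properties.Semiring.Sum (CommutativeRing.semiring ℚ.+-*-commutativeRing)
  using (sum; sum-syntax; sum-cong-≗; sum-init-last; sum-replicate-zero;
         ∑-distrib-+; ∑-comm; *-distribˡ-sum; *-distribʳ-sum)
open +-*-Solver using (solve; _:=_; _:+_; _:*_; _:-_; con)

-- Real arithmetic

≗⇒≃ℝ : ∀ x y → (∀ k → seq x k ≡ seq y k) → x ≃ℝ y
≗⇒≃ℝ x y x≗y ε 0<ε = 0 , λ k _ →
  subst (ℚ._< ε) (sym (cong ∣_∣ (trans (cong (ℚ._- seq y k) (x≗y k)) (ℚ.+-inverseʳ (seq y k))))) 0<ε

≃ℝ-trans : ∀ x y z → x ≃ℝ y → y ≃ℝ z → x ≃ℝ z
≃ℝ-trans x y z x≃y y≃z ε 0<ε = N₁ ℕ.⊔ N₂ , λ k k≥ → subst₂ ℚ._<_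
    (cong ∣_∣ (solve 3 (λ a b c → (a :- b) :+ (b :- c) := a :- c) refl (seq x k) (seq y k) (seq z k)))
    (½+½ ε)
    (∣∣-triangle-< {seq x k ℚ.- seq y k} {seq y k ℚ.- seq z k} (h₁ k (ℕ.m⊔n≤o⇒m≤o N₁ N₂ k≥)) (h₂ k (ℕ.m⊔n≤o⇒n≤o N₁ N₂ k≥)))
  where
  N₁ = proj₁ (x≃y (½ ℚ.* ε) (½-pos 0<ε))
  h₁ = proj₂ (x≃y (½ ℚ.* ε) (½-pos 0<ε))
  N₂ = proj₁ (y≃z (½ ℚ.* ε) (½-pos 0<ε))
  h₂ = proj₂ (y≃z (½ ℚ.* ε) (½-pos 0<ε))

+ℝ-congˡ : ∀ x y z → y ≃ℝ z → x +ℝ y ≃ℝ x +ℝ z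
+ℝ-congˡ x y z y≃z ε 0<ε = proj₁ (y≃z ε 0<ε) , λ k k≥ → subst (ℚ._< ε)
  (cong ∣_∣ (solve 3 (λ a b c → b :- c := (a :+ b) :- (a :+ c)) refl (seq x k) (seq y k) (seq z k)))
  (proj₂ (y≃z ε 0<ε) k k≥)

-- A constant factor scales the error by at most |c|, so a tolerance of ε divided by a positive
-- bound for |c| suffices.
fromℚ-*-congˡ : ∀ c x y → x ≃ℝ y → fromℚ c *ℝ x ≃ℝ fromℚ c *ℝ y
fromℚ-*-congˡ c x y x≃y ε 0<ε = go (divide B ε 0<B 0<ε)
  where
  open ℚ.≤-Reasoning
  -- The added 1 keeps `B` positive even when `c` is 0, so that `ε` can be divided by it.
  B = ∣ c ∣ ℚ.+ 1ℚ
  0<B : 0ℚ ℚ.< B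
  0<B = ℚ.+-mono-≤-< (ℚ.0≤∣p∣ c) (ℚ.positive⁻¹ 1ℚ)
  ∣c∣≤B : ∣ c ∣ ℚ.≤ B
  ∣c∣≤B = subst (ℚ._≤ B) (ℚ.+-identityʳ ∣ c ∣) (ℚ.+-monoʳ-≤ ∣ c ∣ (ℚ.nonNegative⁻¹ 1ℚ))
  go : ∃[ δ ] (0ℚ ℚ.< δ × B ℚ.* δ ≡ ε) → ∃[ N ] (∀ k → N ℕ.≤ k → ∣ c ℚ.* seq x k ℚ.- c ℚ.* seq y k ∣ ℚ.< ε)
  go (δ , 0<δ , Bδ≡ε) = proj₁ (x≃y δ 0<δ) , λ k k≥ → begin-strict
    ∣ c ℚ.* seq x k ℚ.- c ℚ.* seq y k ∣     ≡⟨ cong ∣_∣ (solve 3 (λ c a b → c :* a :- c :* b := c :* (a :- b)) refl c (seq x k) (seq y k)) ⟩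
    ∣ c ℚ.* (seq x k ℚ.- seq y k) ∣         ≡⟨ ℚ.∣p*q∣≡∣p∣*∣q∣ c (seq x k ℚ.- seq y k) ⟩
    ∣ c ∣ ℚ.* ∣ seq x k ℚ.- seq y k ∣       ≤⟨ *-monoʳ-≤ (ℚ.0≤∣p∣ (seq x k ℚ.- seq y k)) ∣c∣≤B ⟩
    B ℚ.* ∣ seq x k ℚ.- seq y k ∣           <⟨ ℚ.*-monoʳ-<-pos B {{ℚ.positive 0<B}} (proj₂ (x≃y δ 0<δ) k k≥) ⟩
    B ℚ.* δ                                 ≡⟨ Bδ≡ε ⟩
    ε                                       ∎

-- The error x - y/z times z is xz - y, and |z| is eventually at least `δ`; hence a tolerance of
-- `ε ℚ.* δ` for the product gives `ε` for the quotient.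
*ℝ⇒/ℝ : ∀ x y z (z#0 : z #0) → x *ℝ z ≃ℝ y → x ≃ℝ y /ℝ z ⟨ z#0 ⟩
*ℝ⇒/ℝ x y z (δ , 0<δ , N₁ , far) xz≃y ε 0<ε = N₁ ℕ.⊔ N₂ , close
  where
  open ℚ.≤-Reasoning
  N₂ = proj₁ (xz≃y (ε ℚ.* δ) (*-pos 0<ε 0<δ))
  h = proj₂ (xz≃y (ε ℚ.* δ) (*-pos 0<ε 0<δ))
  instance
    δ-nonNeg : ℚ.NonNegative δ
    δ-nonNeg = ℚ.nonNegative (ℚ.<⇒≤ 0<δ)
  close : ∀ k → N₁ ℕ.⊔ N₂ ℕ.≤ k → ∣ seq x k ℚ.- seq y k ℚ.* recip (seq z k) ∣ ℚ.< ε
  close k k≥ = ℚ.*-cancelʳ-<-nonNeg δ (begin-strict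
      ∣ a ℚ.- b ℚ.* c′ ∣ ℚ.* δ              ≤⟨ *-monoˡ-≤ (ℚ.0≤∣p∣ (a ℚ.- b ℚ.* c′)) (far k k≥N₁) ⟩
      ∣ a ℚ.- b ℚ.* c′ ∣ ℚ.* ∣ c ∣          ≡⟨ ℚ.∣p*q∣≡∣p∣*∣q∣ (a ℚ.- b ℚ.* c′) c ⟨
      ∣ (a ℚ.- b ℚ.* c′) ℚ.* c ∣            ≡⟨ cong ∣_∣ (solve 4 (λ a b c c′ → (a :- b :* c′) :* c := a :* c :- b :* (c′ :* c)) refl a b c c′) ⟩
      ∣ a ℚ.* c ℚ.- b ℚ.* (c′ ℚ.* c) ∣      ≡⟨ cong (λ e → ∣ a ℚ.* c ℚ.- e ∣) (trans (cong (b ℚ.*_) (recip-inverse c≢0)) (ℚ.*-identityʳ b)) ⟩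
      ∣ a ℚ.* c ℚ.- b ∣                     <⟨ h k (ℕ.m⊔n≤o⇒n≤o N₁ N₂ k≥) ⟩
      ε ℚ.* δ                               ∎)
    where
    a = seq x k
    b = seq y k
    c = seq z k
    c′ = recip c
    k≥N₁ = ℕ.m⊔n≤o⇒m≤o N₁ N₂ k≥
    c≢0 : c ≢ 0ℚ
    c≢0 c≡0 = ℚ.<-irrefl refl (ℚ.<-≤-trans 0<δ (subst (λ e → δ ℚ.≤ ∣ e ∣) c≡0 (far k k≥N₁)))

-- Products of square roots

0≤*0≤ : ∀ {p q} → 0ℚ ℚ.≤ p → 0ℚ ℚ.≤ q → 0ℚ ℚ.≤ p ℚ.* q
0≤*0≤ {p} {q} 0≤p 0≤q = subst (ℚ._≤ p ℚ.* q) (ℚ.*-zeroʳ p) (*-monoˡ-≤ 0≤p 0≤q)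

*-mono-≤ : ∀ {p q r s} → 0ℚ ℚ.≤ p → p ℚ.≤ q → 0ℚ ℚ.≤ r → r ℚ.≤ s → p ℚ.* r ℚ.≤ q ℚ.* s
*-mono-≤ 0≤p p≤q 0≤r r≤s = ℚ.≤-trans (*-monoʳ-≤ 0≤r p≤q) (*-monoˡ-≤ (ℚ.≤-trans 0≤p p≤q) r≤s)

-- `√-approx-bounds` speaks of `q ⊔ 0ℚ`; for nonnegative `q` the truncation disappears.
module √-approx-nonNeg {q : ℚ} (0≤q : 0ℚ ℚ.≤ q) (k : ℕ) where
  private
    s = √-approx q k
    u = unitFrac k

  lower : s ℚ.* s ℚ.≤ q
  lower = subst (s ℚ.* s ℚ.≤_) (ℚ.p≥q⇒p⊔q≡p 0≤q) (√-approx-bounds.lower q k)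

  upper : q ℚ.≤ (s ℚ.+ u) ℚ.* (s ℚ.+ u)
  upper = ℚ.<⇒≤ (subst (ℚ._< (s ℚ.+ u) ℚ.* (s ℚ.+ u)) (ℚ.p≥q⇒p⊔q≡p 0≤q) (√-approx-bounds.upper q k))

  -- A crude bound, but uniform in `k`; it follows from q ≤ (1 + q)².
  √-approx≤1+q : s ℚ.≤ 1ℚ ℚ.+ q
  √-approx≤1+q = square-cancel-≤ (ℚ.+-mono-≤ 0≤1 0≤q) (begin
      s ℚ.* s                             ≤⟨ lower ⟩
      q                                   ≡⟨ ℚ.+-identityʳ q ⟨
      q ℚ.+ 0ℚ                            ≤⟨ ℚ.+-monoʳ-≤ q (ℚ.+-mono-≤ (ℚ.+-mono-≤ 0≤1 0≤q) (0≤*0≤ 0≤q 0≤q)) ⟩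
      q ℚ.+ (1ℚ ℚ.+ q ℚ.+ q ℚ.* q)        ≡⟨ solve 1 (λ q → q :+ (con 1ℚ :+ q :+ q :* q) := (con 1ℚ :+ q) :* (con 1ℚ :+ q)) refl q ⟩
      (1ℚ ℚ.+ q) ℚ.* (1ℚ ℚ.+ q)           ∎)
    where
    open ℚ.≤-Reasoning
    0≤1 : 0ℚ ℚ.≤ 1ℚ
    0≤1 = ℚ.nonNegative⁻¹ 1ℚ

unitFrac≤1 : ∀ k → unitFrac k ℚ.≤ 1ℚ
unitFrac≤1 k = begin
    unitFrac k                              ≡⟨ ℚ.*-identityˡ (unitFrac k) ⟨
    1ℚ ℚ.* unitFrac k                       ≤⟨ *-monoʳ-≤ (0≤unitFrac k) (fromℕ-ℚ-mono-≤ {1} {ℕ.suc k} (ℕ.s≤s ℕ.z≤n)) ⟩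
    fromℕ-ℚ (ℕ.suc k) ℚ.* unitFrac k        ≡⟨ unitFrac-inverse k ⟩
    1ℚ                                      ∎
  where open ℚ.≤-Reasoning

-- With approximations s and t of precision u, comparing squares gives st ≤ r ≤ (s + u)(t + u). The
-- gap (s + t + u)u tends to 0 because s + t + u stays bounded.
√-* : ∀ p q r → 0ℚ ℚ.≤ p → 0ℚ ℚ.≤ q → 0ℚ ℚ.≤ r → p ℚ.* q ≡ r ℚ.* r →
  √ fromℚ p *ℝ √ fromℚ q ≃ℝ fromℚ r
√-* p q r 0≤p 0≤q 0≤r pq≡r² ε 0<ε = go (divide B ε 0<B 0<ε)
  where
  open ℚ.≤-Reasoning
  -- The three summands bound s, t and u at every index.
  B = (1ℚ ℚ.+ p) ℚ.+ (1ℚ ℚ.+ q) ℚ.+ 1ℚ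
  0<1 : 0ℚ ℚ.< 1ℚ
  0<1 = ℚ.positive⁻¹ 1ℚ
  0<B : 0ℚ ℚ.< B
  0<B = +-pos (+-pos (ℚ.+-mono-<-≤ 0<1 0≤p) (ℚ.+-mono-<-≤ 0<1 0≤q)) 0<1

  module _ (k : ℕ) where
    s = √-approx p k
    t = √-approx q k
    u = unitFrac k
    module P = √-approx-nonNeg 0≤p k
    module Q = √-approx-nonNeg 0≤q k
    0≤s = 0≤√-approx p k
    0≤t = 0≤√-approx q k
    0≤u = 0≤unitFrac k

    st≤r : s ℚ.* t ℚ.≤ r
    st≤r = square-cancel-≤ 0≤r (begin
      (s ℚ.* t) ℚ.* (s ℚ.* t)     ≡⟨ solve 2 (λ s t → (s :* t) :* (s :* t) := (s :* s) :* (t :* t)) refl s t ⟩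
      (s ℚ.* s) ℚ.* (t ℚ.* t)     ≤⟨ *-mono-≤ (0≤*0≤ 0≤s 0≤s) P.lower (0≤*0≤ 0≤t 0≤t) Q.lower ⟩
      p ℚ.* q                     ≡⟨ pq≡r² ⟩
      r ℚ.* r                     ∎)

    r≤st+Bu : r ℚ.≤ s ℚ.* t ℚ.+ B ℚ.* u
    r≤st+Bu = begin
      r                                   ≤⟨ square-cancel-≤ (0≤*0≤ (ℚ.+-mono-≤ 0≤s 0≤u) (ℚ.+-mono-≤ 0≤t 0≤u)) r²≤ ⟩
      (s ℚ.+ u) ℚ.* (t ℚ.+ u)             ≡⟨ solve 3 (λ s t u → (s :+ u) :* (t :+ u) := s :* t :+ (s :+ t :+ u) :* u) refl s t u ⟩
      s ℚ.* t ℚ.+ (s ℚ.+ t ℚ.+ u) ℚ.* u   ≤⟨ ℚ.+-monoʳ-≤ (s ℚ.* t) (*-monoʳ-≤ 0≤u (ℚ.+-mono-≤ (ℚ.+-mono-≤ P.√-approx≤1+q Q.√-approx≤1+q) (unitFrac≤1 k))) ⟩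
      s ℚ.* t ℚ.+ B ℚ.* u                 ∎
      where
      r²≤ : r ℚ.* r ℚ.≤ ((s ℚ.+ u) ℚ.* (t ℚ.+ u)) ℚ.* ((s ℚ.+ u) ℚ.* (t ℚ.+ u))
      r²≤ = begin
        r ℚ.* r                                                       ≡⟨ pq≡r² ⟨
        p ℚ.* q                                                       ≤⟨ *-mono-≤ 0≤p P.upper 0≤q Q.upper ⟩
        ((s ℚ.+ u) ℚ.* (s ℚ.+ u)) ℚ.* ((t ℚ.+ u) ℚ.* (t ℚ.+ u))       ≡⟨ solve 2 (λ x y → (x :* x) :* (y :* y) := (x :* y) :* (x :* y)) refl (s ℚ.+ u) (t ℚ.+ u) ⟩
        ((s ℚ.+ u) ℚ.* (t ℚ.+ u)) ℚ.* ((s ℚ.+ u) ℚ.* (t ℚ.+ u))       ∎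

  go : ∃[ δ ] (0ℚ ℚ.< δ × B ℚ.* δ ≡ ε) → ∃[ N ] (∀ k → N ℕ.≤ k → ∣ s k ℚ.* t k ℚ.- r ∣ ℚ.< ε)
  go (δ , 0<δ , Bδ≡ε) = proj₁ (archimedean 0<δ) , λ k k≥ → ∣∣<-both {s k ℚ.* t k} {r} {ε}
    (begin-strict
      s k ℚ.* t k                 ≤⟨ st≤r k ⟩
      r                           ≡⟨ ℚ.+-identityʳ r ⟨
      r ℚ.+ 0ℚ                    <⟨ ℚ.+-monoʳ-< r 0<ε ⟩
      r ℚ.+ ε                     ∎)
    (begin-strict
      r                           ≤⟨ r≤st+Bu k ⟩
      s k ℚ.* t k ℚ.+ B ℚ.* u k   <⟨ ℚ.+-monoʳ-< (s k ℚ.* t k) (ℚ.*-monoʳ-<-pos B {{ℚ.positive 0<B}} (proj₂ (archimedean 0<δ) k k≥)) ⟩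
      s k ℚ.* t k ℚ.+ B ℚ.* δ     ≡⟨ cong (s k ℚ.* t k ℚ.+_) Bδ≡ε ⟩
      s k ℚ.* t k ℚ.+ ε           ∎)

-- Since (a² + a²)·2 = (a + a)², the root times √2 is a + a; dividing by √2 gives the stated form.
√-diagonal : ∀ c a → 0ℚ ℚ.≤ a →
  fromℚ c *ℝ √ (fromℚ a ² +ℝ fromℚ a ²) ≃ℝ fromℚ (c ℚ.* (a ℚ.+ a)) /ℝ √ fromℕ 2 ⟨ √2#0 ⟩
√-diagonal c a 0≤a = *ℝ⇒/ℝ (fromℚ c *ℝ d) (fromℚ (c ℚ.* (a ℚ.+ a))) (√ fromℕ 2) √2#0
  (≃ℝ-trans (fromℚ c *ℝ d *ℝ √ fromℕ 2) (fromℚ c *ℝ (d *ℝ √ fromℕ 2)) (fromℚ c *ℝ fromℚ (a ℚ.+ a))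
    (≗⇒≃ℝ (fromℚ c *ℝ d *ℝ √ fromℕ 2) (fromℚ c *ℝ (d *ℝ √ fromℕ 2)) λ k → ℚ.*-assoc c (seq d k) (seq (√ fromℕ 2) k))
    (fromℚ-*-congˡ c (d *ℝ √ fromℕ 2) (fromℚ (a ℚ.+ a))
      (√-* (a ℚ.* a ℚ.+ a ℚ.* a) (fromℕ-ℚ 2) (a ℚ.+ a)
        (ℚ.+-mono-≤ (0≤*0≤ 0≤a 0≤a) (0≤*0≤ 0≤a 0≤a)) (ℚ.nonNegative⁻¹ (fromℕ-ℚ 2)) (ℚ.+-mono-≤ 0≤a 0≤a)
        (trans (cong ((a ℚ.* a ℚ.+ a ℚ.* a) ℚ.*_) (fromℕ-ℚ-suc 1))
          (solve 1 (λ a → (a :* a :+ a :* a) :* (con 1ℚ :+ con 1ℚ) := (a :+ a) :* (a :+ a)) refl a)))))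
  where
  d = √ (fromℚ a ² +ℝ fromℚ a ²)

-- The equations allow x and y to be fromℕ numerals that are never unfolded into
-- the rational arithmetic of the proof.
regular-value : ∀ S {n p x y} → fromℚ n ≡ x → fromℚ p ≡ y → 0ℚ ℚ.≤ p →
  (∀ k → seq S k ≡ ½ ℚ.* (n ℚ.* p) ℚ.* √-approx (p ℚ.* p ℚ.+ p ℚ.* p) k) →
  S ≃ℝ (x *ℝ y ²) /ℝ √ fromℕ 2 ⟨ √2#0 ⟩
regular-value S {n} {p} refl refl 0≤p S≡ = ≃ℝ-trans S X Z (≗⇒≃ℝ S X S≡)
  (≃ℝ-trans X Y Z
    (√-diagonal c p 0≤p)
    (≗⇒≃ℝ Y Z λ k → cong (ℚ._* recip (seq (√ fromℕ 2) k))
      (solve 2 (λ n p → con ½ :* (n :* p) :* (p :+ p) := n :* (p :* p)) refl n p)))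
  where
  c = ½ ℚ.* (n ℚ.* p)
  X = fromℚ c *ℝ √ (fromℚ p ² +ℝ fromℚ p ²)
  Y = fromℚ (c ℚ.* (p ℚ.+ p)) /ℝ √ fromℕ 2 ⟨ √2#0 ⟩
  Z = (fromℚ n *ℝ fromℚ p ²) /ℝ √ fromℕ 2 ⟨ √2#0 ⟩

-- The mixed-edge summand agrees with its target at every index; only the summand with the root of
-- q² + q² has to pass through `√-diagonal`.
local-value : ∀ S {n p x y} → fromℚ n ≡ x → fromℚ p ≡ y → 0ℚ ℚ.≤ p ℚ.- 1ℚ →
  (∀ k → let q = p ℚ.- 1ℚ in seq S k ≡
    p ℚ.* (n ℚ.- p) ℚ.* √-approx (p ℚ.* p ℚ.+ q ℚ.* q) k
    ℚ.+ ½ ℚ.* (p ℚ.* q ℚ.- (n ℚ.- p) ℚ.* p) ℚ.* √-approx (q ℚ.* q ℚ.+ q ℚ.* q) k) →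
  S ≃ℝ
    y *ℝ (x -ℝ y) *ℝ √ (y ² +ℝ (y -ℝ 1ℝ) ²)
    +ℝ ((y *ℝ (y -ℝ 1ℝ) -ℝ (x -ℝ y) *ℝ y) *ℝ (y -ℝ 1ℝ)) /ℝ √ fromℕ 2 ⟨ √2#0 ⟩
local-value S {n} {p} {x} {y} refl refl 0≤q S≡ = ≃ℝ-trans S (M +ℝ X) (M +ℝ Z)
  (≗⇒≃ℝ S (M +ℝ X) S≡)
  (+ℝ-congˡ M X Z (≃ℝ-trans X Y Z
    (√-diagonal (½ ℚ.* c) q 0≤q)
    (≗⇒≃ℝ Y Z λ k → cong (ℚ._* recip (seq (√ fromℕ 2) k))
      (solve 2 (λ c q → con ½ :* c :* (q :+ q) := c :* q) refl c q))))
  where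
  q = p ℚ.- 1ℚ
  c = p ℚ.* q ℚ.- (n ℚ.- p) ℚ.* p
  M = y *ℝ (x -ℝ y) *ℝ √ (y ² +ℝ (y -ℝ 1ℝ) ²)
  X = fromℚ (½ ℚ.* c) *ℝ √ (fromℚ q ² +ℝ fromℚ q ²)
  Y = fromℚ (½ ℚ.* c ℚ.* (q ℚ.+ q)) /ℝ √ fromℕ 2 ⟨ √2#0 ⟩
  Z = ((y *ℝ (y -ℝ 1ℝ) -ℝ (x -ℝ y) *ℝ y) *ℝ (y -ℝ 1ℝ)) /ℝ √ fromℕ 2 ⟨ √2#0 ⟩

fromℕ-ℚ-+ : ∀ k l → fromℕ-ℚ (k ℕ.+ l) ≡ fromℕ-ℚ k ℚ.+ fromℕ-ℚ l
fromℕ-ℚ-+ zero    l = sym (ℚ.+-identityˡ (fromℕ-ℚ l))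
fromℕ-ℚ-+ (suc k) l = begin
  fromℕ-ℚ (suc (k ℕ.+ l))               ≡⟨ fromℕ-ℚ-suc (k ℕ.+ l) ⟩
  fromℕ-ℚ (k ℕ.+ l) ℚ.+ 1ℚ              ≡⟨ cong (ℚ._+ 1ℚ) (fromℕ-ℚ-+ k l) ⟩
  fromℕ-ℚ k ℚ.+ fromℕ-ℚ l ℚ.+ 1ℚ        ≡⟨ solve 2 (λ a b → a :+ b :+ con 1ℚ := a :+ con 1ℚ :+ b) refl (fromℕ-ℚ k) (fromℕ-ℚ l) ⟩
  fromℕ-ℚ k ℚ.+ 1ℚ ℚ.+ fromℕ-ℚ l        ≡⟨ cong (ℚ._+ fromℕ-ℚ l) (fromℕ-ℚ-suc k) ⟨
  fromℕ-ℚ (suc k) ℚ.+ fromℕ-ℚ l         ∎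
  where open ≡-Reasoning

-- Iverson brackets and finite sums

-- Only the Boolean of the decision enters, so decisions of equivalent propositions give equal
-- values.
𝟙 : ∀ {p} {P : Set p} → Dec P → ℚ
𝟙 P? = if does P? then 1ℚ else 0ℚ

module _ {p q} {P : Set p} {Q : Set q} where
  𝟙-cong : P ⇔ Q → (P? : Dec P) (Q? : Dec Q) → 𝟙 P? ≡ 𝟙 Q?
  𝟙-cong P⇔Q P? Q? = cong (if_then 1ℚ else 0ℚ) (does-⇔ P⇔Q P? Q?)

  𝟙-× : (P? : Dec P) (Q? : Dec Q) → 𝟙 (P? ×-dec Q?) ≡ 𝟙 P? ℚ.* 𝟙 Q?
  𝟙-× (yes _) (yes _) = refl
  𝟙-× (yes _) (no _)  = refl
  𝟙-× (no _)  (yes _) = refl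
  𝟙-× (no _)  (no _)  = refl

module _ {p} {P : Set p} (P? : Dec P) where
  𝟙-true : P → 𝟙 P? ≡ 1ℚ
  𝟙-true p = cong (if_then 1ℚ else 0ℚ) (dec-true P? p)

  𝟙-false : ¬ P → 𝟙 P? ≡ 0ℚ
  𝟙-false ¬p = cong (if_then 1ℚ else 0ℚ) (dec-false P? ¬p)

private
  variable
    ℓ₁ ℓ₂ ℓ₃ : Level
    A : Set ℓ₁
    B : Set ℓ₂

-- List sums lead from the filtered lists behind `edges`, `degree` and `φ` to sums over `Fin n`.
∑ₗ : (A → ℚ) → List A → ℚ
∑ₗ f []       = 0ℚ
∑ₗ f (x ∷ xs) = f x ℚ.+ ∑ₗ f xs

∑ₗ-++ : (f : A → ℚ) (xs ys : List A) → ∑ₗ f (xs ++ ys) ≡ ∑ₗ f xs ℚ.+ ∑ₗ f ys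
∑ₗ-++ f []       ys = sym (ℚ.+-identityˡ (∑ₗ f ys))
∑ₗ-++ f (x ∷ xs) ys = trans (cong (f x ℚ.+_) (∑ₗ-++ f xs ys)) (sym (ℚ.+-assoc (f x) (∑ₗ f xs) (∑ₗ f ys)))

∑ₗ-map : (f : B → ℚ) (g : A → B) (xs : List A) → ∑ₗ f (map g xs) ≡ ∑ₗ (f ∘ g) xs
∑ₗ-map f g []       = refl
∑ₗ-map f g (x ∷ xs) = cong (f (g x) ℚ.+_) (∑ₗ-map f g xs)

∑ₗ-filter : {P : Pred A ℓ₃} (P? : Decidable P) (f : A → ℚ) (xs : List A) →
  ∑ₗ f (filter P? xs) ≡ ∑ₗ (λ x → 𝟙 (P? x) ℚ.* f x) xs
∑ₗ-filter P? f []       = refl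
∑ₗ-filter P? f (x ∷ xs) with P? x
... | yes _ = cong₂ ℚ._+_ (sym (ℚ.*-identityˡ (f x))) (∑ₗ-filter P? f xs)
... | no  _ = trans (∑ₗ-filter P? f xs) (trans (sym (ℚ.+-identityˡ _)) (cong (ℚ._+ _) (sym (ℚ.*-zeroˡ (f x)))))

∑ₗ-cartesianProduct : (f : A × B → ℚ) (xs : List A) (ys : List B) →
  ∑ₗ f (cartesianProduct xs ys) ≡ ∑ₗ (λ x → ∑ₗ (λ y → f (x , y)) ys) xs
∑ₗ-cartesianProduct f []       ys = refl
∑ₗ-cartesianProduct f (x ∷ xs) ys = trans (∑ₗ-++ f (map (x ,_) ys) (cartesianProduct xs ys))
  (cong₂ ℚ._+_ (∑ₗ-map f (x ,_) ys) (∑ₗ-cartesianProduct f xs ys))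

∑ₗ-tabulate : ∀ {n} (f : A → ℚ) (g : Fin n → A) → ∑ₗ f (tabulate g) ≡ sum (f ∘ g)
∑ₗ-tabulate {n = zero}  f g = refl
∑ₗ-tabulate {n = suc n} f g = cong (f (g Fin.zero) ℚ.+_) (∑ₗ-tabulate f (g ∘ Fin.suc))

∑ₗ-applyUpTo : ∀ n (f : A → ℚ) (g : ℕ → A) → ∑ₗ f (applyUpTo g n) ≡ ∑[ i < n ] f (g (toℕ i))
∑ₗ-applyUpTo zero    f g = refl
∑ₗ-applyUpTo (suc n) f g = cong (f (g 0) ℚ.+_) (∑ₗ-applyUpTo n f (g ∘ suc))

length-∑ₗ : (xs : List A) → fromℕ-ℚ (length xs) ≡ ∑ₗ (λ _ → 1ℚ) xs
length-∑ₗ []       = refl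
length-∑ₗ (x ∷ xs) = trans (fromℕ-ℚ-+ 1 (length xs)) (cong (1ℚ ℚ.+_) (length-∑ₗ xs))

length-filter : {P : Pred A ℓ₃} (P? : Decidable P) (xs : List A) →
  fromℕ-ℚ (length (filter P? xs)) ≡ ∑ₗ (𝟙 ∘ P?) xs
length-filter P? xs = trans (length-∑ₗ (filter P? xs)) (trans (∑ₗ-filter P? (λ _ → 1ℚ) xs) (*-1 xs))
  where
  *-1 : ∀ xs → ∑ₗ (λ x → 𝟙 (P? x) ℚ.* 1ℚ) xs ≡ ∑ₗ (𝟙 ∘ P?) xs
  *-1 []       = refl
  *-1 (x ∷ xs) = cong₂ ℚ._+_ (ℚ.*-identityʳ (𝟙 (P? x))) (*-1 xs)

seq-sumℝ : (f : A → ℝ) (xs : List A) (k : ℕ) → seq (sumℝ (map f xs)) k ≡ ∑ₗ (λ x → seq (f x) k) xs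
seq-sumℝ f []       k = refl
seq-sumℝ f (x ∷ xs) k = cong (seq (f x) k ℚ.+_) (seq-sumℝ f xs k)

∑-const : ∀ n c → ∑[ i < n ] c ≡ fromℕ-ℚ n ℚ.* c
∑-const zero    c = sym (ℚ.*-zeroˡ c)
∑-const (suc n) c = begin
  c ℚ.+ ∑[ i < n ] c            ≡⟨ cong (c ℚ.+_) (∑-const n c) ⟩
  c ℚ.+ fromℕ-ℚ n ℚ.* c         ≡⟨ solve 2 (λ n c → c :+ n :* c := (n :+ con 1ℚ) :* c) refl (fromℕ-ℚ n) c ⟩
  (fromℕ-ℚ n ℚ.+ 1ℚ) ℚ.* c      ≡⟨ cong (ℚ._* c) (fromℕ-ℚ-suc n) ⟨
  fromℕ-ℚ (suc n) ℚ.* c         ∎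
  where open ≡-Reasoning

∑-zero : ∀ {n} {f : Fin n → ℚ} → (∀ i → f i ≡ 0ℚ) → sum f ≡ 0ℚ
∑-zero {n} f≡0 = trans (sum-cong-≗ f≡0) (sum-replicate-zero n)

∑-select : ∀ {n} (i : Fin n) (f : Fin n → ℚ) → ∑[ j < n ] (𝟙 (i Fin.≟ j) ℚ.* f j) ≡ f i
∑-select Fin.zero f = trans
  (cong₂ ℚ._+_ (ℚ.*-identityˡ (f Fin.zero)) (∑-zero (λ j → ℚ.*-zeroˡ (f (Fin.suc j)))))
  (ℚ.+-identityʳ (f Fin.zero))
∑-select (Fin.suc i) f = trans
  (cong₂ ℚ._+_ (ℚ.*-zeroˡ (f Fin.zero)) (∑-select i (f ∘ Fin.suc)))
  (ℚ.+-identityˡ (f (Fin.suc i)))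

-- Moving a window of length n one place on drops its first term and gains an equal one at the end.
∑-periodic : ∀ n (f : ℕ → ℚ) → (∀ k → f (k ℕ.+ n) ≡ f k) →
  ∀ m → ∑[ i < n ] f (m ℕ.+ toℕ i) ≡ ∑[ i < n ] f (toℕ i)
∑-periodic n f periodic zero    = refl
∑-periodic n f periodic (suc m) = trans step (∑-periodic n f periodic m)
  where
  open ≡-Reasoning
  g = λ k → f (m ℕ.+ k)
  S = ∑[ i < n ] g (toℕ i)
  S′ = ∑[ i < n ] f (suc m ℕ.+ toℕ i)
  -- The sum of n + 1 consecutive terms is split once at its first term and once at its last.
  first-last : g 0 ℚ.+ S′ ≡ S ℚ.+ g 0
  first-last = begin
    g 0 ℚ.+ S′
      ≡⟨ cong (g 0 ℚ.+_) (sum-cong-≗ {n} λ i → cong f (sym (ℕ.+-suc m (toℕ i)))) ⟩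
    ∑[ i < suc n ] g (toℕ i)
      ≡⟨ sum-init-last {n} (g ∘ toℕ) ⟩
    ∑[ i < n ] g (toℕ (Fin.inject₁ i)) ℚ.+ g (toℕ (Fin.fromℕ n))
      ≡⟨ cong₂ ℚ._+_ (sum-cong-≗ {n} λ i → cong g (Fin.toℕ-inject₁ i)) (cong g (Fin.toℕ-fromℕ n)) ⟩
    S ℚ.+ g n
      ≡⟨ cong (S ℚ.+_) (trans (periodic m) (cong f (sym (ℕ.+-identityʳ m)))) ⟩
    S ℚ.+ g 0 ∎
  step : S′ ≡ S
  step = begin
    S′                              ≡⟨ solve 2 (λ a s → s := (a :+ s) :- a) refl (g 0) S′ ⟩
    g 0 ℚ.+ S′ ℚ.- g 0              ≡⟨ cong (ℚ._- g 0) first-last ⟩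
    S ℚ.+ g 0 ℚ.- g 0               ≡⟨ solve 2 (λ a s → (s :+ a) :- a := s) refl (g 0) S ⟩
    S                               ∎

-- With its indices exchanged, the second copy of the upper triangle becomes the lower one, and the
-- diagonal contributes nothing.
∑∑-triangle : ∀ {n} (f : Fin n → Fin n → ℚ) → (∀ i j → f i j ≡ f j i) → (∀ i → f i i ≡ 0ℚ) →
  let upper = ∑[ i < n ] ∑[ j < n ] (𝟙 (i Fin.<? j) ℚ.* f i j) in
  upper ℚ.+ upper ≡ ∑[ i < n ] ∑[ j < n ] f i j
∑∑-triangle {n} f f-sym f-diag = begin
  upper ℚ.+ upper
    ≡⟨ cong (upper ℚ.+_) (∑-comm u) ⟩
  upper ℚ.+ ∑[ i < n ] ∑[ j < n ] u j i
    ≡⟨ ∑-distrib-+ (λ i → ∑[ j < n ] u i j) (λ i → ∑[ j < n ] u j i) ⟨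
  ∑[ i < n ] (∑[ j < n ] u i j ℚ.+ ∑[ j < n ] u j i)
    ≡⟨ sum-cong-≗ (λ i → trans (sym (∑-distrib-+ (u i) (λ j → u j i))) (sum-cong-≗ (split i))) ⟩
  ∑[ i < n ] ∑[ j < n ] f i j ∎
  where
  open ≡-Reasoning
  u : Fin n → Fin n → ℚ
  u i j = 𝟙 (i Fin.<? j) ℚ.* f i j
  upper = ∑[ i < n ] ∑[ j < n ] u i j
  split : ∀ i j → u i j ℚ.+ u j i ≡ f i j
  split i j with Fin.<-cmp i j
  ... | tri< i<j _ j≮i
    rewrite 𝟙-true (i Fin.<? j) i<j | 𝟙-false (j Fin.<? i) j≮i
    = solve 2 (λ a b → con 1ℚ :* a :+ con 0ℚ :* b := a) refl (f i j) (f j i)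
  ... | tri> i≮j _ j<i
    rewrite 𝟙-false (i Fin.<? j) i≮j | 𝟙-true (j Fin.<? i) j<i | f-sym i j
    = solve 1 (λ a → con 0ℚ :* a :+ con 1ℚ :* a := a) refl (f j i)
  ... | tri≈ i≮j refl _
    rewrite 𝟙-false (i Fin.<? i) i≮j | f-diag i = refl

-- Units of ℤ/n

-- Over ℕ a Bézout identity has one of two forms, 1 + yn = xk or 1 + xk = yn. In the first, x is
-- already the inverse of k.
bézout-inverse : ∀ {k} n .{{_ : NonZero n}} → Coprime k n → ∃[ x ] (x ℕ.* k) ℕ.% n ≡ 1 ℕ.% n
bézout-inverse {k} n coprime with coprime-Bézout coprime
... | Bézout.+- x y 1+yn≡xk = x , trans (cong (ℕ._% n) (sym 1+yn≡xk)) (ℕ.[m+kn]%n≡m%n 1 y n)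
-- xk is −1 modulo n, so its square is 1.
... | Bézout.-+ x y 1+xk≡yn = x ℕ.* (k ℕ.* x) , (begin
    x ℕ.* (k ℕ.* x) ℕ.* k ℕ.% n                 ≡⟨ cong (ℕ._% n) (trans (ℕ.*-assoc x (k ℕ.* x) k)
                                                     (trans (cong (x ℕ.*_) (ℕ.*-assoc k x k)) (sym (ℕ.*-assoc x k m)))) ⟩
    -- Adding yn = 1 + m turns m² into 1 + m(1 + m), which is 1 plus a multiple of n.
    m ℕ.* m ℕ.% n                               ≡⟨ ℕ.[m+kn]%n≡m%n (m ℕ.* m) y n ⟨
    (m ℕ.* m ℕ.+ y ℕ.* n) ℕ.% n                 ≡⟨ cong (λ z → (m ℕ.* m ℕ.+ z) ℕ.% n) 1+xk≡yn ⟨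
    (m ℕ.* m ℕ.+ (1 ℕ.+ m)) ℕ.% n               ≡⟨ cong (ℕ._% n) (trans (ℕ.+-suc (m ℕ.* m) m)
                                                     (cong suc (trans (ℕ.+-comm (m ℕ.* m) m) (sym (ℕ.*-suc m m))))) ⟩
    (1 ℕ.+ m ℕ.* (1 ℕ.+ m)) ℕ.% n               ≡⟨ cong (λ z → (1 ℕ.+ m ℕ.* z) ℕ.% n) 1+xk≡yn ⟩
    (1 ℕ.+ m ℕ.* (y ℕ.* n)) ℕ.% n               ≡⟨ cong (λ z → (1 ℕ.+ z) ℕ.% n) (ℕ.*-assoc m y n) ⟨
    (1 ℕ.+ m ℕ.* y ℕ.* n) ℕ.% n                 ≡⟨ ℕ.[m+kn]%n≡m%n 1 (m ℕ.* y) n ⟩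
    1 ℕ.% n                                     ∎)
  where
  open ≡-Reasoning
  m = x ℕ.* k

-- Degrees and edge sums of the unit graph

module UnitGraph (n : ℕ) .{{_ : NonZero n}} where
  open ≡-Reasoning

  toℕ-mod : ∀ k → toℕ (k ℕ.mod n) ≡ k ℕ.% n
  toℕ-mod k = Fin.toℕ-fromℕ< (ℕ.m%n<n k n)

  -- Stated for every natural `k`, because a sum in `ℤmod n` is by definition the reduction of the
  -- sum of the representatives; adjacency then becomes coprimality of `toℕ i ℕ.+ toℕ j`.
  unit⇔coprime : ∀ k → IsUnit (ℤmod n) (k ℕ.mod n) ⇔ Coprime k n
  unit⇔coprime k = mk⇔ unit⇒coprime coprime⇒unit
    where
    unit⇒coprime : IsUnit (ℤmod n) (k ℕ.mod n) → Coprime k n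
    -- A common divisor of k and n divides zk modulo n, which is 1 modulo n, and hence divides 1.
    unit⇒coprime (z , zk≡1 , _) {d} (d∣k , d∣n) = ∣.∣1⇒≡1 (∣.∣n∣m%n⇒∣m d∣n
      (subst (d ∣_) (trans (sym (toℕ-mod _)) (trans (cong toℕ zk≡1) (toℕ-mod 1)))
        (∣.%-presˡ-∣ (∣.∣n⇒∣m*n (toℕ z) (subst (d ∣_) (sym (toℕ-mod k)) (∣.%-presˡ-∣ d∣k d∣n))) d∣n)))
    coprime⇒unit : Coprime k n → IsUnit (ℤmod n) (k ℕ.mod n)
    coprime⇒unit coprime with bézout-inverse n coprime
    ... | x , xk%n≡1%n = x ℕ.mod n , xk≡1 , trans (CommutativeRing.*-comm (ℤmod n) (k ℕ.mod n) (x ℕ.mod n)) xk≡1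
      where
      xk≡1 : (toℕ (x ℕ.mod n) ℕ.* toℕ (k ℕ.mod n)) ℕ.mod n ≡ 1 ℕ.mod n
      xk≡1 = Fin.toℕ-injective (begin
        toℕ ((toℕ (x ℕ.mod n) ℕ.* toℕ (k ℕ.mod n)) ℕ.mod n)   ≡⟨ toℕ-mod _ ⟩
        (toℕ (x ℕ.mod n) ℕ.* toℕ (k ℕ.mod n)) ℕ.% n           ≡⟨ cong₂ (λ a b → (a ℕ.* b) ℕ.% n) (toℕ-mod x) (toℕ-mod k) ⟩
        ((x ℕ.% n) ℕ.* (k ℕ.% n)) ℕ.% n                       ≡⟨ ℕ.%-distribˡ-* x k n ⟨
        (x ℕ.* k) ℕ.% n                                       ≡⟨ xk%n≡1%n ⟩
        1 ℕ.% n                                               ≡⟨ toℕ-mod 1 ⟨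
        toℕ (1 ℕ.mod n)                                       ∎)

  G = unitGraph (ℤmod n)
  G-finite = unitGraph-ℤmod-finite n
  open SimpleGraph G using (Adj; Adj-sym; Adj-irrefl)
  open IsFinite G-finite using (adj?)

  -- Abstract, since ℚ arithmetic on unfolded numerals would be normalised when
  -- types are compared.
  abstract
    N Φ : ℚ
    N = fromℕ-ℚ n
    Φ = fromℕ-ℚ (φ n)

    N≡ : N ≡ fromℕ-ℚ n
    N≡ = refl

    Φ≡ : Φ ≡ fromℕ-ℚ (φ n)
    Φ≡ = refl

  C : ℕ → ℚ
  C k = 𝟙 (coprime? k n)

  adj : Fin n → Fin n → ℚ
  adj i j = 𝟙 (adj? i j)

  D : Fin n → ℚ
  D i = fromℕ-ℚ (degree G G-finite i)

  coprime-periodic : ∀ k → Coprime (k ℕ.+ n) n ⇔ Coprime k n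
  coprime-periodic k = mk⇔ drop add
    where
    drop : Coprime (k ℕ.+ n) n → Coprime k n
    drop coprime (d∣k , d∣n) = coprime (∣.∣m∣n⇒∣m+n d∣k d∣n , d∣n)
    add : Coprime k n → Coprime (k ℕ.+ n) n
    add coprime = subst (λ m → Coprime m n) (ℕ.+-comm n k) (coprime-+ {k} {n} coprime)

  -- `φ` counts over 1, ..., n, which is the window starting at 1; by periodicity all windows of
  -- length n have the same sum.
  ∑-coprime : ∀ m → ∑[ i < n ] C (m ℕ.+ toℕ i) ≡ Φ
  ∑-coprime m = trans (∑-C m) (sym (trans Φ-∑ (∑-C 1)))
    where
    ∑-C = ∑-periodic n C λ k → 𝟙-cong (coprime-periodic k) (coprime? (k ℕ.+ n) n) (coprime? k n)
    Φ-∑ : Φ ≡ ∑[ i < n ] C (1 ℕ.+ toℕ i)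
    Φ-∑ = trans (trans Φ≡ (length-filter (λ k → coprime? k n) (map suc (upTo n))))
      (trans (cong (∑ₗ C) (map-upTo suc n)) (∑ₗ-applyUpTo n C suc))

  ∑-constN : ∀ c → ∑[ i < n ] c ≡ N ℚ.* c
  ∑-constN c = trans (∑-const n c) (cong (ℚ._* c) (sym N≡))

  adj-sym : ∀ i j → adj i j ≡ adj j i
  adj-sym i j = 𝟙-cong (mk⇔ (Adj-sym {i} {j}) (Adj-sym {j} {i})) (adj? i j) (adj? j i)

  -- Adjacency can differ from coprimality of i + j only on the diagonal, where it fails. Adding the
  -- diagonal term back makes each row a full window of `C`.
  adj-split : ∀ i j → adj i j ℚ.+ 𝟙 (i Fin.≟ j) ℚ.* C (toℕ i ℕ.+ toℕ j) ≡ C (toℕ i ℕ.+ toℕ j)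
  adj-split i j = go (i Fin.≟ j)
    where
    c = C (toℕ i ℕ.+ toℕ j)
    open Equivalence (unit⇔coprime (toℕ i ℕ.+ toℕ j))
    go : Dec (i ≡ j) → adj i j ℚ.+ 𝟙 (i Fin.≟ j) ℚ.* c ≡ c
    go (yes i≡j) = trans
      (cong₂ (λ x y → x ℚ.+ y ℚ.* c) (𝟙-false (adj? i j) (Adj-irrefl {i} i≡j)) (𝟙-true (i Fin.≟ j) i≡j))
      (solve 1 (λ c → con 0ℚ :+ con 1ℚ :* c := c) refl c)
    go (no i≢j) = trans
      (cong₂ (λ x y → x ℚ.+ y ℚ.* c) (𝟙-cong adj⇔coprime (adj? i j) (coprime? (toℕ i ℕ.+ toℕ j) n)) (𝟙-false (i Fin.≟ j) i≢j))
      (solve 1 (λ c → c :+ con 0ℚ :* c := c) refl c)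
      where
      coprime⇒adj : Coprime (toℕ i ℕ.+ toℕ j) n → Adj i j
      coprime⇒adj coprime = i≢j , from coprime
      adj⇔coprime : Adj i j ⇔ Coprime (toℕ i ℕ.+ toℕ j) n
      adj⇔coprime = mk⇔ (to ∘ proj₂) coprime⇒adj

  degree-∑ : ∀ i → D i ≡ ∑[ j < n ] adj i j
  degree-∑ i = trans (length-filter (adj? i) (allFin n)) (∑ₗ-tabulate {n = n} (adj i) id)

  degree-Φ : ∀ i → D i ≡ Φ ℚ.- C (toℕ i ℕ.+ toℕ i)
  degree-Φ i = begin
    D i
      ≡⟨ degree-∑ i ⟩
    ∑[ j < n ] adj i j
      ≡⟨ solve 2 (λ a b → a := (a :+ b) :- b) refl (sum (adj i)) (C (toℕ i ℕ.+ toℕ i)) ⟩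
    ∑[ j < n ] adj i j ℚ.+ C (toℕ i ℕ.+ toℕ i) ℚ.- C (toℕ i ℕ.+ toℕ i)
      ≡⟨ cong (λ z → sum (adj i) ℚ.+ z ℚ.- C (toℕ i ℕ.+ toℕ i)) (∑-select i (λ j → C (toℕ i ℕ.+ toℕ j))) ⟨
    ∑[ j < n ] adj i j ℚ.+ ∑[ j < n ] (𝟙 (i Fin.≟ j) ℚ.* C (toℕ i ℕ.+ toℕ j)) ℚ.- C (toℕ i ℕ.+ toℕ i)
      ≡⟨ cong (ℚ._- C (toℕ i ℕ.+ toℕ i)) (trans (sym (∑-distrib-+ (adj i) _))
           (trans (sum-cong-≗ {n} (adj-split i)) (∑-coprime (toℕ i)))) ⟩
    Φ ℚ.- C (toℕ i ℕ.+ toℕ i) ∎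

  module _ (k : ℕ) where
    SOₖ : ℚ
    SOₖ = seq (SO (unitGraph (ℤmod n)) (unitGraph-ℤmod-finite n)) k

    -- Degrees enter as rationals, so that Φ - 1 involves no truncated subtraction.
    weight : ℚ → ℚ → ℚ
    weight x y = √-approx (x ℚ.* x ℚ.+ y ℚ.* y) k

    weight-sym : ∀ x y → weight x y ≡ weight y x
    weight-sym x y = cong (λ q → √-approx q k) (ℚ.+-comm (x ℚ.* x) (y ℚ.* y))

    -- `edges` keeps the pairs with i < j, so the index is the upper triangle of a symmetric array
    -- with zero diagonal.
    SO-∑∑ : SOₖ ℚ.+ SOₖ ≡
            ∑[ i < n ] ∑[ j < n ] (adj i j ℚ.* weight (D i) (D j))
    SO-∑∑ = trans (cong₂ ℚ._+_ upper upper) (∑∑-triangle f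
      (λ i j → cong₂ ℚ._*_ (adj-sym i j) (weight-sym (D i) (D j)))
      (λ i → trans (cong (ℚ._* weight (D i) (D i)) (𝟙-false (adj? i i) (Adj-irrefl {i} refl))) (ℚ.*-zeroˡ (weight (D i) (D i)))))
      where
      f : Fin n → Fin n → ℚ
      f i j = adj i j ℚ.* weight (D i) (D j)
      upper : SOₖ ≡ ∑[ i < n ] ∑[ j < n ] (𝟙 (i Fin.<? j) ℚ.* f i j)
      upper = begin
        SOₖ
          ≡⟨ seq-sumℝ _ (edges G G-finite) k ⟩
        ∑ₗ w (edges G G-finite)
          ≡⟨ ∑ₗ-filter E? w (cartesianProduct (allFin n) (allFin n)) ⟩
        ∑ₗ (λ e → 𝟙 (E? e) ℚ.* w e) (cartesianProduct (allFin n) (allFin n))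
          ≡⟨ ∑ₗ-cartesianProduct (λ e → 𝟙 (E? e) ℚ.* w e) (allFin n) (allFin n) ⟩
        ∑ₗ (λ i → ∑ₗ (λ j → 𝟙 (E? (i , j)) ℚ.* w (i , j)) (allFin n)) (allFin n)
          ≡⟨ ∑ₗ-tabulate {n = n} _ id ⟩
        ∑[ i < n ] ∑ₗ (λ j → 𝟙 (E? (i , j)) ℚ.* w (i , j)) (allFin n)
          ≡⟨ sum-cong-≗ {n} (λ i → trans (∑ₗ-tabulate {n = n} _ id) (sum-cong-≗ {n} λ j →
               trans (cong (ℚ._* w (i , j)) (𝟙-× (i Fin.<? j) (adj? i j)))
                     (ℚ.*-assoc (𝟙 (i Fin.<? j)) (adj i j) (w (i , j))))) ⟩
        ∑[ i < n ] ∑[ j < n ] (𝟙 (i Fin.<? j) ℚ.* f i j) ∎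
        where
        w : Fin n × Fin n → ℚ
        w (i , j) = weight (D i) (D j)
        E? : Decidable (λ ((i , j) : Fin n × Fin n) → i Fin.< j × Adj i j)
        E? (i , j) = i Fin.<? j ×-dec adj? i j

    -- All degrees equal Φ, so the weight is constant and factors out of the sum of the N row sums.
    SO-regular : (∀ i → ¬ Coprime (toℕ i ℕ.+ toℕ i) n) →
      SOₖ ≡ ½ ℚ.* (N ℚ.* Φ) ℚ.* weight Φ Φ
    SO-regular ¬coprime = halve {y = N ℚ.* Φ} (begin
      SOₖ ℚ.+ SOₖ
        ≡⟨ SO-∑∑ ⟩
      ∑[ i < n ] ∑[ j < n ] (adj i j ℚ.* weight (D i) (D j))
        ≡⟨ sum-cong-≗ {n} (λ i → trans (sum-cong-≗ {n} λ j → cong₂ (λ x y → adj i j ℚ.* weight x y) (D≡Φ i) (D≡Φ j))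
             (trans (sym (*-distribʳ-sum {n} (weight Φ Φ) (adj i)))
               (cong (ℚ._* weight Φ Φ) (trans (sym (degree-∑ i)) (D≡Φ i))))) ⟩
      ∑[ i < n ] (Φ ℚ.* weight Φ Φ)
        ≡⟨ ∑-constN (Φ ℚ.* weight Φ Φ) ⟩
      N ℚ.* (Φ ℚ.* weight Φ Φ)
        ≡⟨ ℚ.*-assoc N Φ (weight Φ Φ) ⟨
      N ℚ.* Φ ℚ.* weight Φ Φ ∎)
      where
      D≡Φ : ∀ i → D i ≡ Φ
      D≡Φ i = trans (degree-Φ i) (trans (cong (λ x → Φ ℚ.- x) (𝟙-false (coprime? (toℕ i ℕ.+ toℕ i) n) (¬coprime i)))
        (ℚ.+-identityʳ Φ))
      halve : ∀ {x y} → x ℚ.+ x ≡ y ℚ.* weight Φ Φ → x ≡ ½ ℚ.* y ℚ.* weight Φ Φ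
      halve {x} {y} 2x≡yw = trans (solve 1 (λ x → x := con ½ :* (x :+ x)) refl x)
        (trans (cong (½ ℚ.*_) 2x≡yw) (sym (ℚ.*-assoc ½ y (weight Φ Φ))))

  -- Prime powers enter only through these two facts: doubling preserves and reflects units, and
  -- nonunits are closed under addition, as in a local ring in which 2 is invertible.
  module Local
    (double : (i : Fin n) → Coprime (toℕ i ℕ.+ toℕ i) n ⇔ Coprime (toℕ i) n)
    (nonunit-+ : (i j : Fin n) → ¬ Coprime (toℕ i) n → ¬ Coprime (toℕ j) n → ¬ Coprime (toℕ i ℕ.+ toℕ j) n)
    where

    unit nonunit : Fin n → ℚ
    unit i = C (toℕ i)
    nonunit i = 1ℚ ℚ.- unit i

    degree-unit : ∀ i → D i ≡ Φ ℚ.- unit i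
    degree-unit i = trans (degree-Φ i)
      (cong (λ x → Φ ℚ.- x) (𝟙-cong (double i) (coprime? (toℕ i ℕ.+ toℕ i) n) (coprime? (toℕ i) n)))

    ∑-nonunit : ∑[ i < n ] nonunit i ≡ N ℚ.- Φ
    ∑-nonunit = begin
      ∑[ i < n ] nonunit i
        ≡⟨ solve 2 (λ x p → x := (x :+ p) :- p) refl (sum nonunit) Φ ⟩
      ∑[ i < n ] nonunit i ℚ.+ Φ ℚ.- Φ
        ≡⟨ cong (λ x → sum nonunit ℚ.+ x ℚ.- Φ) (∑-coprime 0) ⟨
      ∑[ i < n ] nonunit i ℚ.+ ∑[ i < n ] unit i ℚ.- Φ
        ≡⟨ cong (ℚ._- Φ) (trans (sym (∑-distrib-+ {n} nonunit unit))
             (trans (sum-cong-≗ {n} λ i → solve 1 (λ e → (con 1ℚ :- e) :+ e := con 1ℚ) refl (unit i))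
               (trans (∑-constN 1ℚ) (ℚ.*-identityʳ N)))) ⟩
      N ℚ.- Φ ∎

    -- This is the sum of the degrees, each being Φ - 1 with 1 more at a nonunit.
    ∑∑-adj : ∑[ i < n ] ∑[ j < n ] adj i j ≡ N ℚ.* Φ ℚ.- Φ
    ∑∑-adj = begin
      ∑[ i < n ] ∑[ j < n ] adj i j
        ≡⟨ sum-cong-≗ {n} (λ i → trans (sym (degree-∑ i)) (trans (degree-unit i)
             (solve 2 (λ p e → p :- e := (p :- con 1ℚ) :+ (con 1ℚ :- e)) refl Φ (unit i)))) ⟩
      ∑[ i < n ] (Φ ℚ.- 1ℚ ℚ.+ nonunit i)
        ≡⟨ ∑-distrib-+ {n} (λ _ → Φ ℚ.- 1ℚ) nonunit ⟩
      ∑[ i < n ] (Φ ℚ.- 1ℚ) ℚ.+ ∑[ i < n ] nonunit i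
        ≡⟨ cong₂ ℚ._+_ (∑-constN (Φ ℚ.- 1ℚ)) ∑-nonunit ⟩
      N ℚ.* (Φ ℚ.- 1ℚ) ℚ.+ (N ℚ.- Φ)
        ≡⟨ solve 2 (λ n p → n :* (p :- con 1ℚ) :+ (n :- p) := n :* p :- p) refl N Φ ⟩
      N ℚ.* Φ ℚ.- Φ ∎

    -- Only the rows of nonunits contribute; there are N - Φ of them, each of degree Φ.
    ∑∑-adj-nonunitˡ : ∑[ i < n ] ∑[ j < n ] (adj i j ℚ.* nonunit i) ≡ Φ ℚ.* (N ℚ.- Φ)
    ∑∑-adj-nonunitˡ = begin
      ∑[ i < n ] ∑[ j < n ] (adj i j ℚ.* nonunit i)
        ≡⟨ sum-cong-≗ {n} (λ i → trans (sym (*-distribʳ-sum {n} (nonunit i) (adj i)))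
             (trans (cong (ℚ._* nonunit i) (trans (sym (degree-∑ i)) (degree-unit i))) (absorb (coprime? (toℕ i) n)))) ⟩
      ∑[ i < n ] (Φ ℚ.* nonunit i)
        ≡⟨ *-distribˡ-sum {n} Φ nonunit ⟨
      Φ ℚ.* ∑[ i < n ] nonunit i
        ≡⟨ cong (Φ ℚ.*_) ∑-nonunit ⟩
      Φ ℚ.* (N ℚ.- Φ) ∎
      where
      absorb : ∀ {p} {P : Set p} (P? : Dec P) → (Φ ℚ.- 𝟙 P?) ℚ.* (1ℚ ℚ.- 𝟙 P?) ≡ Φ ℚ.* (1ℚ ℚ.- 𝟙 P?)
      absorb (yes _) = solve 1 (λ p → (p :- con 1ℚ) :* (con 1ℚ :- con 1ℚ) := p :* (con 1ℚ :- con 1ℚ)) refl Φ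
      absorb (no _)  = solve 1 (λ p → (p :- con 0ℚ) :* (con 1ℚ :- con 0ℚ) := p :* (con 1ℚ :- con 0ℚ)) refl Φ

    ∑∑-adj-nonunitʳ : ∑[ i < n ] ∑[ j < n ] (adj i j ℚ.* nonunit j) ≡ Φ ℚ.* (N ℚ.- Φ)
    ∑∑-adj-nonunitʳ = trans (∑-comm {n} {n} (λ i j → adj i j ℚ.* nonunit j))
      (trans (sum-cong-≗ {n} λ j → sum-cong-≗ {n} λ i → cong (ℚ._* nonunit j) (adj-sym i j)) ∑∑-adj-nonunitˡ)

    adj-nonunits : ∀ i j → ¬ Coprime (toℕ i) n → ¬ Coprime (toℕ j) n → adj i j ≡ 0ℚ
    adj-nonunits i j ¬i ¬j = 𝟙-false (adj? i j)
      λ (_ , unit-i+j) → nonunit-+ i j ¬i ¬j (Equivalence.to (unit⇔coprime (toℕ i ℕ.+ toℕ j)) unit-i+j)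

    -- Φ - 1 is the degree of a unit, hence a natural number.
    Φ≥1 : ∀ i → Coprime (toℕ i) n → 0ℚ ℚ.≤ Φ ℚ.- 1ℚ
    Φ≥1 i coprime = subst (0ℚ ℚ.≤_)
      (trans (degree-unit i) (cong (λ x → Φ ℚ.- x) (𝟙-true (coprime? (toℕ i) n) coprime)))
      (fromℕ-ℚ-mono-≤ {0} ℕ.z≤n)

    module _ (k : ℕ) where
      w₁ w₂ : ℚ
      w₁ = weight k (Φ ℚ.- 1ℚ) (Φ ℚ.- 1ℚ)
      w₂ = weight k Φ (Φ ℚ.- 1ℚ)

      -- With the unit indicators of the endpoints for `x` and `y`, each summand is a constant times
      -- a term of one of the three double sums computed above.
      linear : ℚ → ℚ → ℚ → ℚ
      linear a x y = w₁ ℚ.* a ℚ.+ ((w₂ ℚ.- w₁) ℚ.* (a ℚ.* (1ℚ ℚ.- x)) ℚ.+ (w₂ ℚ.- w₁) ℚ.* (a ℚ.* (1ℚ ℚ.- y)))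

      -- No two nonunits are adjacent, so an edge has weight w₁ plus w₂ − w₁ for each nonunit endpoint.
      weight-linear : ∀ i j → adj i j ℚ.* weight k (D i) (D j) ≡ linear (adj i j) (unit i) (unit j)
      weight-linear i j = trans (cong₂ (λ x y → adj i j ℚ.* weight k x y) (degree-unit i) (degree-unit j))
        (go (coprime? (toℕ i) n) (coprime? (toℕ j) n))
        where
        a = adj i j
        Claim : ℚ → ℚ → Set
        Claim x y = a ℚ.* weight k (Φ ℚ.- x) (Φ ℚ.- y) ≡ linear a x y
        Φ-0 : Φ ℚ.- 0ℚ ≡ Φ
        Φ-0 = ℚ.+-identityʳ Φ
        go : Dec (Coprime (toℕ i) n) → Dec (Coprime (toℕ j) n) → Claim (unit i) (unit j)
        go (yes ci) (yes cj) = subst₂ Claim (sym (𝟙-true (coprime? (toℕ i) n) ci)) (sym (𝟙-true (coprime? (toℕ j) n) cj))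
          (solve 3 (λ a w₁ w₂ → a :* w₁ := w₁ :* a :+
            ((w₂ :- w₁) :* (a :* (con 1ℚ :- con 1ℚ)) :+ (w₂ :- w₁) :* (a :* (con 1ℚ :- con 1ℚ)))) refl a w₁ w₂)
        go (yes ci) (no ¬cj) = subst₂ Claim (sym (𝟙-true (coprime? (toℕ i) n) ci)) (sym (𝟙-false (coprime? (toℕ j) n) ¬cj))
          (trans (cong (a ℚ.*_) (trans (weight-sym k (Φ ℚ.- 1ℚ) (Φ ℚ.- 0ℚ)) (cong (λ x → weight k x (Φ ℚ.- 1ℚ)) Φ-0)))
            (solve 3 (λ a w₁ w₂ → a :* w₂ := w₁ :* a :+
            ((w₂ :- w₁) :* (a :* (con 1ℚ :- con 1ℚ)) :+ (w₂ :- w₁) :* (a :* (con 1ℚ :- con 0ℚ)))) refl a w₁ w₂))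
        go (no ¬ci) (yes cj) = subst₂ Claim (sym (𝟙-false (coprime? (toℕ i) n) ¬ci)) (sym (𝟙-true (coprime? (toℕ j) n) cj))
          (trans (cong (a ℚ.*_) (cong (λ x → weight k x (Φ ℚ.- 1ℚ)) Φ-0))
            (solve 3 (λ a w₁ w₂ → a :* w₂ := w₁ :* a :+
            ((w₂ :- w₁) :* (a :* (con 1ℚ :- con 0ℚ)) :+ (w₂ :- w₁) :* (a :* (con 1ℚ :- con 1ℚ)))) refl a w₁ w₂))
        -- For an edge the formula would give 2w₂ - w₁, which need not be its weight; but two
        -- nonunits are not adjacent, so both sides are 0.
        go (no ¬ci) (no ¬cj) = subst (λ a → a ℚ.* weight k (Φ ℚ.- unit i) (Φ ℚ.- unit j) ≡ linear a (unit i) (unit j))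
          (sym (adj-nonunits i j ¬ci ¬cj))
          (solve 5 (λ w w₁ w₂ x y → con 0ℚ :* w := w₁ :* con 0ℚ :+ ((w₂ :- w₁) :* (con 0ℚ :* (con 1ℚ :- x)) :+ (w₂ :- w₁) :* (con 0ℚ :* (con 1ℚ :- y))))
            refl (weight k (Φ ℚ.- unit i) (Φ ℚ.- unit j)) w₁ w₂ (unit i) (unit j))

      ∑∑-distribˡ : ∀ c (f : Fin n → Fin n → ℚ) →
        ∑[ i < n ] ∑[ j < n ] (c ℚ.* f i j) ≡ c ℚ.* ∑[ i < n ] ∑[ j < n ] f i j
      ∑∑-distribˡ c f = trans (sum-cong-≗ {n} λ i → sym (*-distribˡ-sum {n} c (f i)))
        (sym (*-distribˡ-sum {n} c (λ i → ∑[ j < n ] f i j)))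

      ∑∑-distrib-+ : ∀ (f g : Fin n → Fin n → ℚ) →
        ∑[ i < n ] ∑[ j < n ] (f i j ℚ.+ g i j) ≡ ∑[ i < n ] ∑[ j < n ] f i j ℚ.+ ∑[ i < n ] ∑[ j < n ] g i j
      ∑∑-distrib-+ f g = trans (sum-cong-≗ {n} λ i → ∑-distrib-+ {n} (f i) (g i))
        (∑-distrib-+ {n} (λ i → ∑[ j < n ] f i j) (λ i → ∑[ j < n ] g i j))

      SO-local : SOₖ k ≡
        Φ ℚ.* (N ℚ.- Φ) ℚ.* w₂ ℚ.+ ½ ℚ.* (Φ ℚ.* (Φ ℚ.- 1ℚ) ℚ.- (N ℚ.- Φ) ℚ.* Φ) ℚ.* w₁
      SO-local = begin
        SOₖ k
          ≡⟨ solve 1 (λ x → x := con ½ :* (x :+ x)) refl (SOₖ k) ⟩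
        ½ ℚ.* (SOₖ k ℚ.+ SOₖ k)
          ≡⟨ cong (½ ℚ.*_) (trans (SO-∑∑ k) (sum-cong-≗ {n} λ i → sum-cong-≗ {n} λ j → weight-linear i j)) ⟩
        ½ ℚ.* ∑[ i < n ] ∑[ j < n ] linear (adj i j) (unit i) (unit j)
          ≡⟨ cong (½ ℚ.*_) (trans (∑∑-distrib-+ f₀ (λ i j → f₁ i j ℚ.+ f₂ i j)) (cong (∑∑f₀ ℚ.+_) (∑∑-distrib-+ f₁ f₂))) ⟩
        ½ ℚ.* (∑∑f₀ ℚ.+ (∑[ i < n ] ∑[ j < n ] f₁ i j ℚ.+ ∑[ i < n ] ∑[ j < n ] f₂ i j))
          ≡⟨ cong (½ ℚ.*_) (cong₂ ℚ._+_
               (trans (∑∑-distribˡ w₁ adj) (cong (w₁ ℚ.*_) ∑∑-adj))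
               (cong₂ ℚ._+_
                 (trans (∑∑-distribˡ (w₂ ℚ.- w₁) (λ i j → adj i j ℚ.* nonunit i)) (cong ((w₂ ℚ.- w₁) ℚ.*_) ∑∑-adj-nonunitˡ))
                 (trans (∑∑-distribˡ (w₂ ℚ.- w₁) (λ i j → adj i j ℚ.* nonunit j)) (cong ((w₂ ℚ.- w₁) ℚ.*_) ∑∑-adj-nonunitʳ)))) ⟩
        ½ ℚ.* (w₁ ℚ.* (N ℚ.* Φ ℚ.- Φ) ℚ.+ ((w₂ ℚ.- w₁) ℚ.* (Φ ℚ.* (N ℚ.- Φ)) ℚ.+ (w₂ ℚ.- w₁) ℚ.* (Φ ℚ.* (N ℚ.- Φ))))
          ≡⟨ solve 4 (λ n p w₁ w₂ →
               con ½ :* (w₁ :* (n :* p :- p) :+ ((w₂ :- w₁) :* (p :* (n :- p)) :+ (w₂ :- w₁) :* (p :* (n :- p))))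
               := p :* (n :- p) :* w₂ :+ con ½ :* (p :* (p :- con 1ℚ) :- (n :- p) :* p) :* w₁) refl N Φ w₁ w₂ ⟩
        Φ ℚ.* (N ℚ.- Φ) ℚ.* w₂ ℚ.+ ½ ℚ.* (Φ ℚ.* (Φ ℚ.- 1ℚ) ℚ.- (N ℚ.- Φ) ℚ.* Φ) ℚ.* w₁ ∎
        where
        f₀ f₁ f₂ : Fin n → Fin n → ℚ
        f₀ i j = w₁ ℚ.* adj i j
        f₁ i j = (w₂ ℚ.- w₁) ℚ.* (adj i j ℚ.* nonunit i)
        f₂ i j = (w₂ ℚ.- w₁) ℚ.* (adj i j ℚ.* nonunit j)
        ∑∑f₀ = ∑[ i < n ] ∑[ j < n ] f₀ i j

-- Coprimality to a power of an odd prime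

∣p^α⇒≡1 : ∀ {p d} → Prime p → ∀ α → ¬ p ∣ d → d ∣ p ^ α → d ≡ 1
∣p^α⇒≡1 {p} {d} p-prime zero    p∤d d∣1 = ∣.∣1⇒≡1 d∣1
-- Since d is coprime to p, one factor p can be cancelled from the multiple of d.
∣p^α⇒≡1 {p} {d} p-prime (suc α) p∤d d∣pp^α = ∣p^α⇒≡1 p-prime α p∤d (coprime-divisor d-coprime-p d∣pp^α)
  where
  d-coprime-p : Coprime d p
  d-coprime-p (c∣d , c∣p) with prime⇒irreducible p-prime c∣p
  ... | inj₁ c≡1  = c≡1
  ... | inj₂ refl = contradiction c∣d p∤d

-- As α is positive, p divides p^α, so p is a common divisor whenever it divides k. Conversely, if p
-- does not divide k, it divides no common divisor, and `∣p^α⇒≡1` applies.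
coprime-p^α⇔ : ∀ {p} → Prime p → ∀ α → 1 ≤ α → ∀ k → Coprime k (p ^ α) ⇔ (¬ p ∣ k)
coprime-p^α⇔ {p} p-prime (suc α) _ k = mk⇔ coprime⇒∤ ∤⇒coprime
  where
  coprime⇒∤ : Coprime k (p ^ suc α) → ¬ p ∣ k
  coprime⇒∤ coprime p∣k = ¬prime[1] (subst Prime (coprime (p∣k , ∣.m∣m*n (p ^ α))) p-prime)
  ∤⇒coprime : ¬ p ∣ k → Coprime k (p ^ suc α)
  ∤⇒coprime p∤k (d∣k , d∣p^α) = ∣p^α⇒≡1 p-prime (suc α) (λ p∣d → p∤k (∣.∣-trans p∣d d∣k)) d∣p^α

-- Euclid's lemma for 2m leaves two cases, and p > 2 rules out that p divides 2.
∣m+m⇒∣m : ∀ {p} → Prime p → 2 < p → ∀ m → p ∣ m ℕ.+ m → p ∣ m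
∣m+m⇒∣m {p} p-prime 2<p m p∣m+m
  with euclidsLemma 2 m p-prime (subst (λ x → p ∣ m ℕ.+ x) (sym (ℕ.+-identityʳ m)) p∣m+m)
... | inj₁ p∣2 = contradiction (∣.∣⇒≤ p∣2) (ℕ.<⇒≱ 2<p)
... | inj₂ p∣m = p∣m

theorem4p1 :
    (n : ℕ) .{{_ : NonZero n}} → 2 ≤ n → (p : ℕ) → Prime p →
    let SO[G] = SO (unitGraph (ℤmod n)) (unitGraph-ℤmod-finite n)
        N = fromℕ n
        Φ = fromℕ (φ n)
    in
      (2 ∣ n → SO[G] ≃ℝ (N *ℝ Φ ²) /ℝ √ fromℕ 2 ⟨ √2#0 ⟩)
      ×
      ((α : ℕ) → 1 ≤ α → 2 < p → n ≡ p ^ α →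
        SO[G] ≃ℝ
          Φ *ℝ (N -ℝ Φ) *ℝ √ (Φ ² +ℝ (Φ -ℝ 1ℝ) ²)
          +ℝ ((Φ *ℝ (Φ -ℝ 1ℝ) -ℝ (N -ℝ Φ) *ℝ Φ) *ℝ (Φ -ℝ 1ℝ)) /ℝ √ fromℕ 2 ⟨ √2#0 ⟩)
theorem4p1 n 2≤n p p-prime = even , prime-power
  where
  open UnitGraph n

  even : 2 ∣ n → SO (unitGraph (ℤmod n)) (unitGraph-ℤmod-finite n) ≃ℝ (fromℕ n *ℝ fromℕ (φ n) ²) /ℝ √ fromℕ 2 ⟨ √2#0 ⟩
  even 2∣n = regular-value (SO (unitGraph (ℤmod n)) (unitGraph-ℤmod-finite n))
    {N} {Φ} {fromℕ n} {fromℕ (φ n)} (cong fromℚ N≡) (cong fromℚ Φ≡)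
    (subst (0ℚ ℚ.≤_) (sym Φ≡) (fromℕ-ℚ-mono-≤ {0} ℕ.z≤n)) λ k → SO-regular k 2i-nonunit
    where
    2i-nonunit : ∀ i → ¬ Coprime (toℕ i ℕ.+ toℕ i) n
    2i-nonunit i coprime = contradiction (coprime (2∣2i , 2∣n)) λ ()
      where
      2∣2i : 2 ∣ toℕ i ℕ.+ toℕ i
      2∣2i = subst (λ x → 2 ∣ toℕ i ℕ.+ x) (ℕ.+-identityʳ (toℕ i)) (∣.m∣m*n (toℕ i))

  prime-power : (α : ℕ) → 1 ≤ α → 2 < p → n ≡ p ^ α →
    SO (unitGraph (ℤmod n)) (unitGraph-ℤmod-finite n) ≃ℝ
      fromℕ (φ n) *ℝ (fromℕ n -ℝ fromℕ (φ n)) *ℝ √ (fromℕ (φ n) ² +ℝ (fromℕ (φ n) -ℝ 1ℝ) ²)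
      +ℝ ((fromℕ (φ n) *ℝ (fromℕ (φ n) -ℝ 1ℝ) -ℝ (fromℕ n -ℝ fromℕ (φ n)) *ℝ fromℕ (φ n)) *ℝ (fromℕ (φ n) -ℝ 1ℝ))
        /ℝ √ fromℕ 2 ⟨ √2#0 ⟩
  prime-power α 1≤α 2<p n≡p^α = local-value (SO (unitGraph (ℤmod n)) (unitGraph-ℤmod-finite n))
    {N} {Φ} {fromℕ n} {fromℕ (φ n)} (cong fromℚ N≡) (cong fromℚ Φ≡)
    -- Read as 1 < n, the bound 2 ≤ n provides the residue 1, a unit, which shows that Φ - 1 is
    -- nonnegative.
    (Φ≥1 (Fin.fromℕ< 2≤n) 1-coprime) SO-local
    where
    ∤⇔ : ∀ k → Coprime k n ⇔ (¬ p ∣ k)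
    ∤⇔ k = subst (λ m → Coprime k m ⇔ (¬ p ∣ k)) (sym n≡p^α) (coprime-p^α⇔ p-prime α 1≤α k)
    module _ {k : ℕ} where
      open Equivalence (∤⇔ k) public using () renaming (to to coprime⇒∤; from to ∤⇒coprime)

    ¬coprime⇒∣ : ∀ {k} → ¬ Coprime k n → p ∣ k
    ¬coprime⇒∣ {k} ¬coprime with p ∣.∣? k
    ... | yes p∣k = p∣k
    ... | no  p∤k = contradiction (λ {d} → ∤⇒coprime {k} p∤k {d}) ¬coprime

    double : ∀ i → Coprime (toℕ i ℕ.+ toℕ i) n ⇔ Coprime (toℕ i) n
    double i = mk⇔ halve twice
      where
      halve : Coprime (toℕ i ℕ.+ toℕ i) n → Coprime (toℕ i) n
      halve coprime = ∤⇒coprime λ p∣i → coprime⇒∤ {toℕ i ℕ.+ toℕ i} coprime (∣.∣m∣n⇒∣m+n p∣i p∣i)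
      twice : Coprime (toℕ i) n → Coprime (toℕ i ℕ.+ toℕ i) n
      twice coprime = ∤⇒coprime λ p∣2i → coprime⇒∤ {toℕ i} coprime (∣m+m⇒∣m p-prime 2<p (toℕ i) p∣2i)

    nonunit-+ : ∀ i j → ¬ Coprime (toℕ i) n → ¬ Coprime (toℕ j) n → ¬ Coprime (toℕ i ℕ.+ toℕ j) n
    nonunit-+ i j ¬i ¬j coprime = coprime⇒∤ {toℕ i ℕ.+ toℕ j} coprime (∣.∣m∣n⇒∣m+n (¬coprime⇒∣ ¬i) (¬coprime⇒∣ ¬j))

    open Local double nonunit-+

    1-coprime : Coprime (toℕ (Fin.fromℕ< 2≤n)) n
    1-coprime = subst (λ m → Coprime m n) (sym (Fin.toℕ-fromℕ< 2≤n)) (Coprimality.1-coprimeTo n)
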